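{- For every positive integer $n$, the conjugation map defined below is an involution on the set of partitions of $[n]=\{1,\ldots,n\}$. Moreover, for every partition $\pi$ of $[n]$, the number of singletons of the conjugate of $\pi$ equals the number of adjacencies of $\pi$, and the number of adjacencies of the conjugate of $\pi$ equals the number of singletons of $\pi$.
   Context: Partitions on finite sets of positive integers: a partition $\pi$ of a finite set $A\subset\mathbb{Z}_{>0}$ (its support, $\mathrm{supp}(\pi)=A$) is a set of nonempty pairwise disjoint blocks with union $A$; the empty partition $\epsilon$ has empty support. List $A=\{a_1<a_2<\cdots<a_m\}$; the successor of $a_i$ is $a_{i+1}$ for $i<m$ and the successor of $a_m$ is $a_1$ (cyclic). An element $a$ is an adjacency initiator of $\pi$ if $a$ and its successor $b\neq a$ lie in the same block, in which case $b$ is an adjacency terminator and $(a,b)$ is an adjacency; if $|A|=1$, its unique element is considered to be both an adjacency initiator and an adjacency terminator (and it is also a singleton). An element is a singleton if it forms a block by itself. For the partitions of $[n]$ this gives: singletons are one-element blocks and adjacencies are pairs $(i,i+1)$ or $(n,1)$ within one block. Define $\mathrm{SeparateIS}(\pi)=(\rho,(I,S))$, where $I$ is the set of adjacency initiators of $\pi$, $S$ the set of singleton elements of $\pi$, and $\rho$ is the partition of $\mathrm{supp}(\pi)\setminus(I\cup S)$ obtained from $\pi$ by deleting the elements of $I\cup S$ from their blocks (and discarding blocks that become empty). Define $\mathrm{SeparateST}(\pi)=(\rho,(T,S))$ analogously, with $T$ the set of adjacency terminators of $\pi$ and $\rho$ obtained by deleting $T\cup S$. Both maps are injective and have the same image;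 let $\mathrm{CombineST}$ denote the inverse of $\mathrm{SeparateST}$ on this image. The map $\phi$ on partitions of $[n]$: given $\pi$, set $\rho_0=\pi$ and $(\rho_j,(I_j,S_j))=\mathrm{SeparateIS}(\rho_{j-1})$ for $j=1,2,\ldots$, stopping at the first $k\ge1$ for which $\rho_k$ has no adjacency initiators and no singletons. Then set $\tau_k=\rho_k$ and $\tau_{j-1}=\mathrm{CombineST}(\tau_j,(I_j,S_j))$ for $j=k,k-1,\ldots,1$, and define $\phi(\pi)=\tau_0$. The complement of a partition $\pi$ of $[n]$ is the partition obtained by replacing each element $x$ by $n+1-x$. The conjugate of $\pi$ is the complement of $\phi(\pi)$.
   Formalization: In defining φ, the rebuilding step is corrected to CombineST(τ_j,(S_j,I_j)): I_j returns as singletons and S_j as adjacency terminators. With (I_j,S_j) as written the claim fails: for n=2, {1}{2} would be its own conjugate, with 2 singletons but 0 adjacencies. -}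

module Defs where

open import Data.Bool using (Bool; true; false; _∧_; _∨_; not; if_then_else_)
open import Data.Nat using (ℕ; zero; suc; _≡ᵇ_; _<ᵇ_; _≤_; _∸_; _+_)
open import Data.Nat.Properties using (≤-decTotalOrder) renaming (_≟_ to _≟ℕ_)
open import Data.List using (List; []; _∷_; [_]; _++_; map; concat; concatMap; length; foldr; null) renaming (filterᵇ to filter; deduplicateᵇ to dedup)
open import Data.Bool.ListAction using (any)
open import Data.List.Properties using (≡-dec)
open import Data.List.Relation.Unary.All using (All)
open import Data.List.Relation.Unary.Unique.Propositional using (Unique)
open import Data.List.Membership.Propositional using (_∈_)
open import Data.Product using (_×_; _,_; proj₁; proj₂)
open import Data.Product.Properties using () renaming (≡-dec to ×-≡-dec)
open import Function.Bundles using (_⇔_)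
open import Relation.Nullary using (Dec; yes; no; does)
open import Relation.Binary.PropositionalEquality using (_≡_; _≢_)
open import Data.List.Sort.InsertionSort ≤-decTotalOrder using (sort)

-- Raw representation: a partition is a list of blocks, each block a list
-- of positive integers.  Sets are compared through a canonical form
-- (see `norm`): blocks increasing, blocks ordered by their minima.

Block : Set
Block = List ℕ

Partition : Set
Partition = List Block

_∈ᵇ_ : ℕ → List ℕ → Bool
a ∈ᵇ B = any (a ≡ᵇ_) B

supp : Partition → List ℕ
supp π = sort (concat π)

sameBlock : Partition → ℕ → ℕ → Bool
sameBlock π a b = any (λ B → (a ∈ᵇ B) ∧ (b ∈ᵇ B)) π

isBlockMin : Partition → List ℕ → ℕ → Bool
isBlockMin π A x = not (any (λ y → (y <ᵇ x) ∧ sameBlock π y x) A)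

norm : Partition → Partition
norm π = map (λ x → filter (λ y → sameBlock π x y) A) (filter (isBlockMin π A) A)
  where A = supp π

-- Cyclic successor in a finite set A (given as an increasing list)

successor : List ℕ → ℕ → ℕ
successor A a with filter (λ b → a <ᵇ b) A
... | b ∷ _ = b
... | [] with A
...   | c ∷ _ = c
...   | [] = a

isInitiator : Partition → ℕ → Bool
isInitiator π a = (length A ≡ᵇ 1) ∨ (not (successor A a ≡ᵇ a) ∧ sameBlock π a (successor A a))
  where A = supp π

isTerminator : Partition → ℕ → Bool
isTerminator π b =
  (length A ≡ᵇ 1) ∨
  any (λ a → not (successor A a ≡ᵇ a) ∧ sameBlock π a (successor A a) ∧ (successor A a ≡ᵇ b)) A
  where A = supp π

isSingleton : Partition → ℕ → Bool
isSingleton π a = any (λ B → (length B ≡ᵇ 1) ∧ (a ∈ᵇ B)) π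

initiators : Partition → List ℕ
initiators π = filter (isInitiator π) (supp π)

terminators : Partition → List ℕ
terminators π = filter (isTerminator π) (supp π)

singletons : Partition → List ℕ
singletons π = filter (isSingleton π) (supp π)

adjacencies : Partition → List (ℕ × ℕ)
adjacencies π = map (λ a → a , successor (supp π) a) (initiators π)

deleteElems : List ℕ → Partition → Partition
deleteElems X π = norm (filter (λ B → not (null B)) (map (filter (λ y → not (y ∈ᵇ X))) π))

SeparateIS : Partition → Partition × (List ℕ × List ℕ)
SeparateIS π = deleteElems (initiators π ++ singletons π) π , (initiators π , singletons π)

SeparateST : Partition → Partition × (List ℕ × List ℕ)
SeparateST π = deleteElems (terminators π ++ singletons π) π , (terminators π , singletons π)

-- CombineST: inverse of SeparateST on its image, realised by searching
-- among all set partitions of supp(τ) ∪ T ∪ S.  (Junk value τ if the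
-- argument is not in the image.)

insertions : ℕ → Partition → List Partition
insertions x [] = []
insertions x (B ∷ p) = ((x ∷ B) ∷ p) ∷ map (B ∷_) (insertions x p)

allPartitions : List ℕ → List Partition
allPartitions [] = [ [] ]
allPartitions (x ∷ xs) = concatMap (λ p → ([ x ] ∷ p) ∷ insertions x p) (allPartitions xs)

private
  decP : (x y : Partition × (List ℕ × List ℕ)) → Dec (x ≡ y)
  decP = ×-≡-dec (≡-dec (≡-dec _≟ℕ_)) (×-≡-dec (≡-dec _≟ℕ_) (≡-dec _≟ℕ_))

firstWith : (Partition → Bool) → Partition → List Partition → Partition
firstWith p d [] = d
firstWith p d (c ∷ cs) = if p c then c else firstWith p d cs

CombineST : Partition → List ℕ × List ℕ → Partition
CombineST τ (T , S) =
  firstWith (λ c → does (decP (SeparateST c) (τ , (T , S)))) τ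
            (map norm (allPartitions (sort (dedup _≡ᵇ_ (concat τ ++ T ++ S)))))

-- Iterate SeparateIS: returns [(I₁,S₁),…,(I_k,S_k)] and ρ_k.
-- The fuel bounds the number of additional steps (each strictly shrinks
-- the support, so |supp π| is enough).
separateLoop : ℕ → Partition → List (List ℕ × List ℕ) × Partition
separateLoop fuel ρ with SeparateIS ρ
... | ρ' , IS with null (initiators ρ') ∧ null (singletons ρ') | fuel
...   | true  | _      = [ IS ] , ρ'
...   | false | zero   = [ IS ] , ρ'
...   | false | suc f  = IS ∷ proj₁ (separateLoop f ρ') , proj₂ (separateLoop f ρ')

-- τ_{j-1} = CombineST(τ_j, ·) applied with the roles of the two sets
-- exchanged: I_j is put back as the singleton set and S_j as the set of
-- adjacency terminators.
φ : Partition → Partition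
φ π = foldr (λ IS τ → CombineST τ (proj₂ IS , proj₁ IS)) (proj₂ r) (proj₁ r)
  where r = separateLoop (length (supp π)) π

complement : ℕ → Partition → Partition
complement n π = norm (map (map (λ x → suc n ∸ x)) π)

conjugate : ℕ → Partition → Partition
conjugate n π = complement n (φ π)

record PartitionOf (n : ℕ) (π : Partition) : Set where
  field
    blocksNonempty : All (λ B → null B ≡ false) π
    disjoint       : Unique (concat π)
    support        : ∀ x → (x ∈ concat π) ⇔ (1 ≤ x × x ≤ n)
    canonical      : norm π ≡ π

module Submission where

open import Defs
open import Data.Bool using (Bool; true; false; T; _∧_; _∨_; not)
open import Data.Bool.ListAction using (any)
open import Data.Bool.Properties using (T-∧; T-∨; T?)
open import Data.Empty using (⊥; ⊥-elim)
open import Data.List using (List; []; _∷_; [_]; _++_; map; concat; length; filter; filterᵇ; foldr; null; deduplicateᵇ)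
open import Data.List.Membership.Propositional using (_∈_; _∉_; find; lose)
open import Data.List.Membership.Propositional.Properties
  using (∈-filter⁺; ∈-filter⁻; ∈-map⁺; ∈-map⁻; ∈-concat⁺′; ∈-concat⁻′; ∈-concatMap⁺; ∈-concatMap⁻; ∈-++⁺ˡ; ∈-++⁺ʳ; ∈-++⁻)
open import Data.List.Properties using (map-cong-local; filter-++; filter-notAll; concat-map; length-map; ≡-dec)
open import Data.List.Relation.Binary.Disjoint.Propositional using (Disjoint)
open import Data.List.Relation.Binary.Permutation.Propositional using (_↭_; ↭-refl; ↭-sym; ↭-trans; ↭⇒↭ₛ; prep)
open import Data.List.Relation.Binary.Permutation.Propositional.Properties using (∈-resp-↭; ↭-length; shift; ++⁺ˡ)
import Data.List.Relation.Binary.Permutation.Setoid.Properties as Permutationₛ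
open import Data.List.Relation.Unary.All as All using (All; []; _∷_)
open import Data.List.Relation.Unary.AllPairs as AllPairs using (AllPairs; []; _∷_)
import Data.List.Relation.Unary.AllPairs.Properties as AllPairs
open import Data.List.Relation.Unary.Any as Any using (here; there)
open import Data.List.Relation.Unary.Any.Properties using (any⁺; any⁻)
open import Data.List.Relation.Unary.Sorted.TotalOrder.Properties using (Sorted⇒AllPairs)
open import Data.List.Relation.Unary.Unique.Propositional using (Unique)
import Data.List.Relation.Unary.Unique.Propositional.Properties as Unique
open import Data.Nat using (ℕ; zero; suc; _∸_; _≤_; _<_; _≡ᵇ_; _<ᵇ_)
open import Data.Nat.Induction using (<-wellFounded)
open import Data.Nat.Properties
  using (_≟_; ≤-refl; ≤-trans; ≤-antisym; ≤-pred; ≤∧≢⇒<; ≮⇒≥; <-irrefl; <-asym; <-trans; <-cmp; <⇒≢; <ᵇ⇒<; <⇒<ᵇ; ≡ᵇ⇒≡; ≡⇒≡ᵇ;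
         m<n⇒0<n∸m; m∸n≤m; m∸[m∸n]≡n; m≤n⇒m≤1+n; ∸-monoʳ-<; ≤-totalOrder; ≤-decTotalOrder)
open import Data.List.Membership.DecPropositional _≟_ using (_∈?_)
open import Data.List.Sort.InsertionSort ≤-decTotalOrder using (sort)
open import Data.List.Sort.InsertionSort.Properties ≤-decTotalOrder using (sort-↭; sort-↗)
open import Data.Product using (∃; ∃-syntax; _×_; _,_; proj₁; proj₂)
open import Data.Product.Properties using () renaming (≡-dec to ×-≡-dec)
open import Data.Sum using (_⊎_; inj₁; inj₂; map₂)
open import Function using (_∘_; Equivalence; case_of_)
open import Function.Bundles using (mk⇔)
open import Induction.WellFounded using (Acc; acc)
open import Level using (Level)
open import Relation.Binary.Definitions using (tri<; tri≈; tri>)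
open import Relation.Binary.PropositionalEquality
  using (_≡_; _≢_; refl; sym; trans; cong; subst; subst₂; setoid)
open import Relation.Nullary using (¬_; Dec; yes; no; does; ¬?; _×-dec_)

-- Deleting the adjacency terminators T and the singletons S loses nothing: each element lies
-- in the block of its anchor, the last element outside T met when walking cyclically backwards,
-- and distinct anchors sharing a block survive in the rest ρ. Conversely, let (ρ, I, S) come from
-- SeparateIS, and let σ be a partition of supp ρ whose terminators are the singletons of ρ and
-- whose singletons are the adjacency initiators of ρ. Then (σ, S, I) lies in the image of
-- SeparateST, because the successor of an initiator of ρ lies in S and the predecessor of a
-- singleton of ρ lies in I. Hence the pairs (π, φ π) are exactly those linked by a chain of
-- separations with I and S exchanged. Complementation reverses the cyclic order, so it swaps
-- SeparateIS with SeparateST and carries a chain from π to τ to one from the complement of τ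
-- to the complement of π.

-- `CombineST` is a search that means something only on the image of `SeparateST`, and `φ` runs on
-- fuel, so neither is easy to invert directly. The chain relation `Conj` replaces them: the two
-- ends of a step differ only in orientation, so reflection reverses the step, and the relation is
-- functional because `SeparateST` is injective. Membership in the image is the hard half. Every
-- element of `S` has to join its predecessor in order to become a terminator. The two facts about
-- neighbours ensure that this gluing goes no further: the one about singletons of `ρ` excludes
-- terminators outside `S`, the one about initiators of `ρ` excludes singletons outside `I`. The
-- degenerate case is a support with one element. That element is initiator, terminator and
-- singleton at once, so `I` and `S` overlap and the gluing argument breaks down; this case is
-- treated apart.

-- Booleans, filters and duplicate-free lists.

T-ext : ∀ {a b} → (T a → T b) → (T b → T a) → a ≡ b
T-ext {true}  {true}  _ _ = refl
T-ext {true}  {false} f _ = ⊥-elim (f _)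
T-ext {false} {true}  _ g = ⊥-elim (g _)
T-ext {false} {false} _ _ = refl

T-not⁺ : ∀ {a} → ¬ T a → T (not a)
T-not⁺ {true}  f = f _
T-not⁺ {false} _ = _

T-not⁻ : ∀ {a} → T (not a) → ¬ T a
T-not⁻ {false} _ ()

module _ {ℓ : Level} {X : Set ℓ} where

  any-intro : ∀ (p : X → Bool) {xs x} → x ∈ xs → T (p x) → T (any p xs)
  any-intro p x∈ px = any⁺ p (lose x∈ px)

  any-elim : ∀ (p : X → Bool) {xs} → T (any p xs) → ∃[ x ] (x ∈ xs × T (p x))
  any-elim p t = find (any⁻ p _ t)

  ∈-filterᵇ⁺ : ∀ (p : X → Bool) {xs x} → x ∈ xs → T (p x) → x ∈ filterᵇ p xs
  ∈-filterᵇ⁺ p = ∈-filter⁺ (T? ∘ p)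

  ∈-filterᵇ⁻ : ∀ (p : X → Bool) {xs x} → x ∈ filterᵇ p xs → x ∈ xs × T (p x)
  ∈-filterᵇ⁻ p = ∈-filter⁻ (T? ∘ p)

  filterᵇ-cong : ∀ {p q : X → Bool} xs → (∀ {x} → x ∈ xs → p x ≡ q x) → filterᵇ p xs ≡ filterᵇ q xs
  filterᵇ-cong [] _ = refl
  filterᵇ-cong {p} {q} (x ∷ xs) eq with p x | q x | eq (here refl)
  ... | true  | _ | refl = cong (x ∷_) (filterᵇ-cong xs (eq ∘ there))
  ... | false | _ | refl = filterᵇ-cong xs (eq ∘ there)

  AllPairs-mapLocal : ∀ {r s} {R : X → X → Set r} {S : X → X → Set s} {xs} →
    (∀ {x y} → x ∈ xs → y ∈ xs → R x y → S x y) → AllPairs R xs → AllPairs S xs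
  AllPairs-mapLocal f []       = []
  AllPairs-mapLocal f (r ∷ rs) =
    All.tabulate (λ y∈ → f (here refl) (there y∈) (All.lookup r y∈)) ∷
    AllPairs-mapLocal (λ x∈ y∈ → f (there x∈) (there y∈)) rs

  unique-++⁻ʳ : ∀ (xs : List X) {ys} → Unique (xs ++ ys) → Unique ys
  unique-++⁻ʳ []       u       = u
  unique-++⁻ʳ (_ ∷ xs) (_ ∷ u) = unique-++⁻ʳ xs u

  unique-++⁻ˡ : ∀ (xs : List X) {ys} → Unique (xs ++ ys) → Unique xs
  unique-++⁻ˡ []       _       = []
  unique-++⁻ˡ (_ ∷ xs) (n ∷ u) = All.tabulate (All.lookup n ∘ ∈-++⁺ˡ) ∷ unique-++⁻ˡ xs u

  unique-++⇒disjoint : ∀ (xs : List X) {ys} → Unique (xs ++ ys) → Disjoint xs ys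
  unique-++⇒disjoint (x ∷ xs) (n ∷ _) (here refl , y∈) = All.lookup n (∈-++⁺ʳ xs y∈) refl
  unique-++⇒disjoint (_ ∷ xs) (_ ∷ u) (there x∈ , y∈) = unique-++⇒disjoint xs u (x∈ , y∈)

  unique-concat⇒≡ : ∀ {xss : List (List X)} → Unique (concat xss) → ∀ {B C x} →
    B ∈ xss → C ∈ xss → x ∈ B → x ∈ C → B ≡ C
  unique-concat⇒≡ {xs ∷ xss} u (here refl) (here refl) _ _ = refl
  unique-concat⇒≡ {xs ∷ xss} u (here refl) (there C∈) x∈ x∈′ =
    ⊥-elim (unique-++⇒disjoint xs u (x∈ , ∈-concat⁺′ x∈′ C∈))
  unique-concat⇒≡ {xs ∷ xss} u (there B∈) (here refl) x∈ x∈′ =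
    ⊥-elim (unique-++⇒disjoint xs u (x∈′ , ∈-concat⁺′ x∈ B∈))
  unique-concat⇒≡ {xs ∷ xss} u (there B∈) (there C∈) = unique-concat⇒≡ (unique-++⁻ʳ xs u) B∈ C∈

  unique-concat⇒block : ∀ {xss : List (List X)} → Unique (concat xss) → ∀ {B} → B ∈ xss → Unique B
  unique-concat⇒block {xs ∷ xss} u (here refl) = unique-++⁻ˡ xs u
  unique-concat⇒block {xs ∷ xss} u (there B∈)  = unique-concat⇒block (unique-++⁻ʳ xs u) B∈

∈ᵇ⁺ : ∀ {a B} → a ∈ B → T (a ∈ᵇ B)
∈ᵇ⁺ {a} a∈ = any-intro (a ≡ᵇ_) a∈ (≡⇒≡ᵇ a a refl)

∈ᵇ⁻ : ∀ {a B} → T (a ∈ᵇ B) → a ∈ B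
∈ᵇ⁻ {a} t with any-elim (a ≡ᵇ_) t
... | b , b∈ , eq with refl ← ≡ᵇ⇒≡ a b eq = b∈

-- Finite sets as increasing lists.

Increasing : List ℕ → Set
Increasing = AllPairs _<_

increasing⇒unique : ∀ {xs} → Increasing xs → Unique xs
increasing⇒unique = AllPairs.map <⇒≢

increasing-filterᵇ : ∀ p {xs} → Increasing xs → Increasing (filterᵇ p xs)
increasing-filterᵇ p = AllPairs.filter⁺ (T? ∘ p)

-- Turns equality of sets into equality of lists: supports and the two sets of a separation are all
-- held as increasing lists.
increasing-ext : ∀ {xs ys} → Increasing xs → Increasing ys →
  (∀ {z} → z ∈ xs → z ∈ ys) → (∀ {z} → z ∈ ys → z ∈ xs) → xs ≡ ys
increasing-ext {[]}    {[]}    _ _ _ _ = refl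
increasing-ext {[]}    {_ ∷ _} _ _ _ g with () ← g (here refl)
increasing-ext {_ ∷ _} {[]}    _ _ f _ with () ← f (here refl)
increasing-ext {x ∷ xs} {y ∷ ys} (x< ∷ ix) (y< ∷ iy) f g with f (here refl) | g (here refl)
... | there x∈  | there y∈ = ⊥-elim (<-asym (All.lookup x< y∈) (All.lookup y< x∈))
... | here refl | _        = cong (x ∷_) (increasing-ext ix iy (tail x< f) (tail y< g))
  where
  tail : ∀ {us vs} → All (x <_) us → (∀ {z} → z ∈ x ∷ us → z ∈ x ∷ vs) → ∀ {z} → z ∈ us → z ∈ vs
  tail x<us h z∈ with h (there z∈)
  ... | here refl = ⊥-elim (<-irrefl refl (All.lookup x<us z∈))
  ... | there z∈′ = z∈′
... | there x∈  | here refl = ⊥-elim (<-irrefl refl (All.lookup y< x∈))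

∈-sort⁺ : ∀ {xs z} → z ∈ xs → z ∈ sort xs
∈-sort⁺ {xs} = ∈-resp-↭ (↭-sym (sort-↭ xs))

∈-sort⁻ : ∀ {xs z} → z ∈ sort xs → z ∈ xs
∈-sort⁻ {xs} = ∈-resp-↭ (sort-↭ xs)

length-sort : ∀ xs → length (sort xs) ≡ length xs
length-sort xs = ↭-length (sort-↭ xs)

sort-increasing : ∀ {xs} → Unique xs → Increasing (sort xs)
sort-increasing {xs} u =
  AllPairs.map (λ (m≤n , m≢n) → ≤∧≢⇒< m≤n m≢n)
    (AllPairs.zip (Sorted⇒AllPairs ≤-totalOrder (sort-↗ xs) ,
                   Permutationₛ.Unique-resp-↭ (setoid ℕ) (↭⇒↭ₛ (↭-sym (sort-↭ xs))) u))

∈-dedup⁺ : ∀ {z} xs → z ∈ xs → z ∈ deduplicateᵇ _≡ᵇ_ xs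
∈-dedup⁺ (x ∷ xs) (here refl) = here refl
∈-dedup⁺ {z} (x ∷ xs) (there z∈) with x ≟ z
... | yes refl = here refl
... | no x≢z   = there (∈-filter⁺ _ (∈-dedup⁺ xs z∈) (x≢z ∘ ≡ᵇ⇒≡ x z))

∈-dedup⁻ : ∀ {z} xs → z ∈ deduplicateᵇ _≡ᵇ_ xs → z ∈ xs
∈-dedup⁻ (x ∷ xs) (here refl) = here refl
∈-dedup⁻ (x ∷ xs) (there z∈)  = there (∈-dedup⁻ xs (proj₁ (∈-filter⁻ _ z∈)))

dedup-unique : ∀ xs → Unique (deduplicateᵇ _≡ᵇ_ xs)
dedup-unique []       = []
dedup-unique (x ∷ xs) =
  All.tabulate (λ {y} y∈ x≡y → proj₂ (∈-filter⁻ _ {xs = deduplicateᵇ _≡ᵇ_ xs} y∈) (≡⇒≡ᵇ x y x≡y)) ∷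
  Unique.filter⁺ _ (dedup-unique xs)

-- Partitions as equivalence relations.

record SameBlock (π : Partition) (x y : ℕ) : Set where
  constructor inBlock
  field
    {block} : Block
    block∈  : block ∈ π
    left∈   : x ∈ block
    right∈  : y ∈ block

sameBlock⁺ : ∀ π {x y} → SameBlock π x y → T (sameBlock π x y)
sameBlock⁺ π (inBlock B∈ x∈ y∈) = any-intro _ B∈ (Equivalence.from T-∧ (∈ᵇ⁺ x∈ , ∈ᵇ⁺ y∈))

sameBlock⁻ : ∀ π {x y} → T (sameBlock π x y) → SameBlock π x y
sameBlock⁻ π t with any-elim _ t
... | B , B∈ , t′ with x∈ , y∈ ← Equivalence.to T-∧ t′ = inBlock B∈ (∈ᵇ⁻ x∈) (∈ᵇ⁻ y∈)

SameBlock-sym : ∀ {π x y} → SameBlock π x y → SameBlock π y x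
SameBlock-sym (inBlock B∈ x∈ y∈) = inBlock B∈ y∈ x∈

SameBlock-trans : ∀ {π} → Unique (concat π) → ∀ {x y z} →
  SameBlock π x y → SameBlock π y z → SameBlock π x z
SameBlock-trans u (inBlock B∈ x∈ y∈) (inBlock C∈ y∈′ z∈)
  with refl ← unique-concat⇒≡ u B∈ C∈ y∈ y∈′ = inBlock B∈ x∈ z∈

SameBlock-refl : ∀ π {x} → x ∈ supp π → SameBlock π x x
SameBlock-refl π x∈ with ∈-concat⁻′ π (∈-sort⁻ x∈)
... | B , x∈B , B∈ = inBlock B∈ x∈B x∈B

SameBlock⇒∈ˡ : ∀ {π x y} → SameBlock π x y → x ∈ supp π
SameBlock⇒∈ˡ (inBlock B∈ x∈ _) = ∈-sort⁺ (∈-concat⁺′ x∈ B∈)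

SameBlock⇒∈ʳ : ∀ {π x y} → SameBlock π x y → y ∈ supp π
SameBlock⇒∈ʳ = SameBlock⇒∈ˡ ∘ SameBlock-sym

-- Reflexivity is confined to `A` because `sameBlock` fails outside the support.
record EquivalenceOn (A : List ℕ) (r : ℕ → ℕ → Bool) : Set where
  field
    refl-on : ∀ {x} → x ∈ A → T (r x x)
    symm    : ∀ {x y} → T (r x y) → T (r y x)
    tran    : ∀ {x y z} → T (r x y) → T (r y z) → T (r x z)

sameBlock-equivalence : ∀ π → Unique (concat π) → EquivalenceOn (supp π) (sameBlock π)
sameBlock-equivalence π u = record
  { refl-on = λ x∈ → sameBlock⁺ π (SameBlock-refl π x∈)
  ; symm    = λ {x} {y} s → sameBlock⁺ π (SameBlock-sym (sameBlock⁻ π {x} {y} s))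
  ; tran    = λ {x} {y} {z} s t →
      sameBlock⁺ π (SameBlock-trans u (sameBlock⁻ π {x} {y} s) (sameBlock⁻ π {y} {z} t))
  }

isMinimum : List ℕ → (ℕ → ℕ → Bool) → ℕ → Bool
isMinimum A r x = not (any (λ y → (y <ᵇ x) ∧ r y x) A)

-- norm π is definitionally classes (supp π) (sameBlock π).
classes : List ℕ → (ℕ → ℕ → Bool) → Partition
classes A r = map (λ x → filterᵇ (r x) A) (filterᵇ (isMinimum A r) A)

classes-cong : ∀ {A r s} → (∀ {x y} → x ∈ A → y ∈ A → r x y ≡ s x y) → classes A r ≡ classes A s
classes-cong {A} {r} {s} eq = trans
  (cong (map _) (filterᵇ-cong A minima))
  (map-cong-local (All.tabulate λ x∈ → filterᵇ-cong A (eq (proj₁ (∈-filterᵇ⁻ _ x∈)))))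
  where
  transfer : ∀ {r s} → (∀ {x y} → x ∈ A → y ∈ A → r x y ≡ s x y) →
    ∀ {x} → x ∈ A → T (isMinimum A r x) → T (isMinimum A s x)
  transfer eq {x} x∈ min = T-not⁺ λ t → case-any (any-elim _ t)
    where
    case-any : ∃[ y ] (y ∈ A × T ((y <ᵇ x) ∧ _)) → ⊥
    case-any (y , y∈ , t) with y<x , syx ← Equivalence.to T-∧ t =
      T-not⁻ min (any-intro _ y∈ (Equivalence.from T-∧ (y<x , subst T (sym (eq y∈ x∈)) syx)))
  minima : ∀ {x} → x ∈ A → isMinimum A r x ≡ isMinimum A s x
  minima x∈ = T-ext (transfer eq x∈) (transfer (λ a b → sym (eq a b)) x∈)

record Valid (π : Partition) : Set where
  field
    unique    : Unique (concat π)
    canonical : norm π ≡ π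

  supp-increasing : Increasing (supp π)
  supp-increasing = sort-increasing unique

open Valid

module Classes {A : List ℕ} {r : ℕ → ℕ → Bool} (inc : Increasing A) (equiv : EquivalenceOn A r) where
  open EquivalenceOn equiv

  -- The head of the increasing list of all elements related to `a`. Anything smaller and related to
  -- it would, by transitivity, occur in that list as well.
  minimum-exists : ∀ {a} → a ∈ A → ∃[ m ] (m ∈ filterᵇ (isMinimum A r) A × T (r m a))
  minimum-exists {a} a∈ with filterᵇ (λ y → r y a) A in eq
  ... | [] with () ← subst (a ∈_) eq (∈-filterᵇ⁺ (λ y → r y a) a∈ (refl-on a∈))
  ... | m ∷ ms with m∈ , rma ← ∈-filterᵇ⁻ (λ y → r y a) {A} (subst (m ∈_) (sym eq) (here refl))
               with (m< ∷ _) ← subst Increasing eq (increasing-filterᵇ (λ y → r y a) inc) =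
    m , ∈-filterᵇ⁺ _ m∈ (T-not⁺ λ t → notBelow (any-elim _ t)) , rma
    where
    notBelow : ∃[ y ] (y ∈ A × T ((y <ᵇ m) ∧ r y m)) → ⊥
    notBelow (y , y∈ , t) with y<m , rym ← Equivalence.to T-∧ t
                          with subst (y ∈_) eq (∈-filterᵇ⁺ (λ y → r y a) y∈ (tran rym rma))
    ... | here refl = <-irrefl refl (<ᵇ⇒< y m y<m)
    ... | there y∈′ = <-asym (All.lookup m< y∈′) (<ᵇ⇒< y m y<m)

  minimum≮ : ∀ {m k} → m ∈ A → k ∈ filterᵇ (isMinimum A r) A → T (r m k) → ¬ m < k
  minimum≮ m∈ k∈ rmk m<k =
    T-not⁻ (proj₂ (∈-filterᵇ⁻ _ {A} k∈)) (any-intro _ m∈ (Equivalence.from T-∧ (<⇒<ᵇ m<k , rmk)))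

  SameBlock-classes⁺ : ∀ {x y} → x ∈ A → y ∈ A → T (r x y) → SameBlock (classes A r) x y
  SameBlock-classes⁺ x∈ y∈ rxy with m , m∈ , rmx ← minimum-exists x∈ =
    inBlock (∈-map⁺ _ m∈) (∈-filterᵇ⁺ _ x∈ rmx) (∈-filterᵇ⁺ _ y∈ (tran rmx rxy))

  SameBlock-classes⁻ : ∀ {x y} → SameBlock (classes A r) x y → x ∈ A × y ∈ A × T (r x y)
  SameBlock-classes⁻ (inBlock B∈ x∈ y∈) with m , m∈ , refl ← ∈-map⁻ _ B∈
    with x∈A , rmx ← ∈-filterᵇ⁻ _ {A} x∈ | y∈A , rmy ← ∈-filterᵇ⁻ _ {A} y∈ =
    x∈A , y∈A , tran (symm rmx) rmy

  classes-unique : Unique (concat (classes A r))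
  classes-unique = Unique.concat⁺
    (All.tabulate λ B∈ → blockUnique (∈-map⁻ _ B∈))
    (AllPairs.map⁺ (AllPairs-mapLocal disjoint (increasing-filterᵇ _ inc)))
    where
    blockUnique : ∀ {B} → ∃[ m ] (m ∈ filterᵇ (isMinimum A r) A × B ≡ filterᵇ (r m) A) → Unique B
    blockUnique (m , _ , refl) = increasing⇒unique (increasing-filterᵇ (r m) inc)
    disjoint : ∀ {m k} → m ∈ filterᵇ (isMinimum A r) A → k ∈ filterᵇ (isMinimum A r) A → m < k →
      Disjoint (filterᵇ (r m) A) (filterᵇ (r k) A)
    disjoint m∈ k∈ m<k (z∈m , z∈k) =
      minimum≮ (proj₁ (∈-filterᵇ⁻ _ m∈)) k∈
        (tran (proj₂ (∈-filterᵇ⁻ _ {A} z∈m)) (symm (proj₂ (∈-filterᵇ⁻ _ {A} z∈k)))) m<k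

  supp-classes : supp (classes A r) ≡ A
  supp-classes = increasing-ext (sort-increasing classes-unique) inc
    (λ z∈ → proj₁ (SameBlock-classes⁻ (SameBlock-refl (classes A r) z∈)))
    (λ z∈ → SameBlock⇒∈ˡ (SameBlock-classes⁺ z∈ z∈ (refl-on z∈)))

  classes-valid : Valid (classes A r)
  classes-valid .unique = classes-unique
  classes-valid .canonical =
    trans (cong (λ S → classes S (sameBlock (classes A r))) supp-classes)
      (classes-cong λ x∈ y∈ → T-ext
        (λ t → proj₂ (proj₂ (SameBlock-classes⁻ (sameBlock⁻ (classes A r) t))))
        (λ t → sameBlock⁺ (classes A r) (SameBlock-classes⁺ x∈ y∈ t)))

  classes-nonempty : All (λ B → null B ≡ false) (classes A r)
  classes-nonempty = All.tabulate λ B∈ → nonempty (∈-map⁻ _ B∈)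
    where
    nonempty : ∀ {B} → ∃[ m ] (m ∈ filterᵇ (isMinimum A r) A × B ≡ filterᵇ (r m) A) → null B ≡ false
    nonempty (m , m∈ , refl) with filterᵇ (r m) A in eq
    ... | _ ∷ _ = refl
    ... | [] with m∈A ← proj₁ (∈-filterᵇ⁻ _ {A} m∈)
             with () ← subst (m ∈_) eq (∈-filterᵇ⁺ (r m) m∈A (refl-on m∈A))

module _ {q : Partition} (u : Unique (concat q)) where
  private module C = Classes (sort-increasing u) (sameBlock-equivalence q u)

  norm-valid : Valid (norm q)
  norm-valid = C.classes-valid

  norm-nonempty : All (λ B → null B ≡ false) (norm q)
  norm-nonempty = C.classes-nonempty

  SameBlock-norm⁺ : ∀ {x y} → SameBlock q x y → SameBlock (norm q) x y
  SameBlock-norm⁺ s = C.SameBlock-classes⁺ (SameBlock⇒∈ˡ s) (SameBlock⇒∈ʳ s) (sameBlock⁺ q s)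

  SameBlock-norm⁻ : ∀ {x y} → SameBlock (norm q) x y → SameBlock q x y
  SameBlock-norm⁻ s = sameBlock⁻ q (proj₂ (proj₂ (C.SameBlock-classes⁻ s)))

norm-ext : ∀ {π σ} → Unique (concat π) → Unique (concat σ) →
  (∀ {x y} → SameBlock π x y → SameBlock σ x y) →
  (∀ {x y} → SameBlock σ x y → SameBlock π x y) → norm π ≡ norm σ
norm-ext {π} {σ} uπ uσ f g =
  trans (cong (λ A → classes A (sameBlock π)) supp≡)
        (classes-cong {supp σ} {sameBlock π} {sameBlock σ} λ {x} {y} _ _ → T-ext
          (λ t → sameBlock⁺ σ (f (sameBlock⁻ π {x} {y} t)))
          (λ t → sameBlock⁺ π (g (sameBlock⁻ σ {x} {y} t))))
  where
  supp≡ : supp π ≡ supp σ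
  supp≡ = increasing-ext (sort-increasing uπ) (sort-increasing uσ)
    (λ z∈ → SameBlock⇒∈ˡ (f (SameBlock-refl π z∈))) (λ z∈ → SameBlock⇒∈ˡ (g (SameBlock-refl σ z∈)))

valid-ext : ∀ {π σ} → Valid π → Valid σ →
  (∀ {x y} → SameBlock π x y → SameBlock σ x y) →
  (∀ {x y} → SameBlock σ x y → SameBlock π x y) → π ≡ σ
valid-ext vπ vσ f g =
  trans (sym (canonical vπ)) (trans (norm-ext (unique vπ) (unique vσ) f g) (canonical vσ))

-- Cyclic orders: successors, anchors and walks.

-- The axioms of a strict total cyclic order. They are kept abstract because the theory is run in
-- both directions: anchors are sought backwards to invert `SeparateST`, and forwards to analyse
-- `SeparateIS`.
record IsCyclicOrder (cyc : ℕ → ℕ → ℕ → Set) : Set where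
  field
    rotate : ∀ {x y z} → cyc x y z → cyc y z x
    asym   : ∀ {x y z} → cyc x y z → ¬ cyc z y x
    transitive  : ∀ {x y z w} → cyc x y z → cyc x z w → cyc x y w
    total  : ∀ {x y z} → x ≢ y → y ≢ z → x ≢ z → cyc x y z ⊎ cyc z y x

  irrefl₁₃ : ∀ {x y} → ¬ cyc x y x
  irrefl₁₃ c = asym c c

  irrefl₁₂ : ∀ {x y} → ¬ cyc x x y
  irrefl₁₂ c = irrefl₁₃ (rotate c)

  irrefl₂₃ : ∀ {x y} → ¬ cyc x y y
  irrefl₂₃ c = irrefl₁₂ (rotate c)

opposite : ∀ {cyc} → IsCyclicOrder cyc → IsCyclicOrder (λ x y z → cyc z y x)
opposite isCyc = record
  { rotate = λ c → rotate (rotate c)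
  ; asym   = λ c → asym c
  ; transitive  = λ c d → rotate (transitive (rotate (rotate d)) (rotate (rotate c)))
  ; total  = λ p q r → total (q ∘ sym) (p ∘ sym) (r ∘ sym)
  } where open IsCyclicOrder isCyc

module Cyclic {cyc : ℕ → ℕ → ℕ → Set} (isCyclic : IsCyclicOrder cyc) where
  open IsCyclicOrder isCyclic

  -- The field `loop` is needed because `gap` is vacuous for `x` equal to `y`; without it every
  -- element would count as its own successor.
  record Succ (A : List ℕ) (x y : ℕ) : Set where
    constructor mkSucc
    field
      source∈ : x ∈ A
      target∈ : y ∈ A
      gap     : ∀ {z} → z ∈ A → ¬ cyc x z y
      loop    : x ≡ y → ∀ {z} → z ∈ A → z ≡ x

  open Succ

  Succ-unique : ∀ {A x y z} → Succ A x y → Succ A x z → y ≡ z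
  Succ-unique {x = x} {y} {z} s t with y ≟ z | x ≟ y | x ≟ z
  ... | yes e | _     | _     = e
  ... | no _  | yes e | _     rewrite loop s e (target∈ t) = sym e
  ... | no _  | no _  | yes e rewrite loop t e (target∈ s) = e
  ... | no n  | no p  | no q with total p n q
  ...   | inj₁ c = ⊥-elim (gap t (target∈ s) c)
  ...   | inj₂ c = ⊥-elim (gap s (target∈ t) (rotate (rotate c)))

  -- The last element of N met when walking backwards from x, starting with x itself.
  record Anchor (N : List ℕ) (x v : ℕ) : Set where
    constructor mkAnchor
    field
      anchor∈ : v ∈ N
      between : ∀ {z} → z ∈ N → ¬ cyc v z x
      fixed   : x ∈ N → v ≡ x

  open Anchor

  -- Of two candidates different from `x`, one lies strictly between the other and `x`. The field
  -- `fixed` settles the case of `x` in `N`, where `between` alone would also admit the preceding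
  -- element of `N`.
  Anchor-unique : ∀ {N x v w} → Anchor N x v → Anchor N x w → v ≡ w
  Anchor-unique {N} {x} {v} {w} a b with v ≟ w | v ≟ x | w ≟ x
  ... | yes e | _        | _        = e
  ... | no _  | yes refl | _        = sym (fixed b (anchor∈ a))
  ... | no _  | no _     | yes refl = fixed a (anchor∈ b)
  ... | no n  | no p     | no q with total n q p
  ...   | inj₁ c = ⊥-elim (between a (anchor∈ b) c)
  ...   | inj₂ c = ⊥-elim (between b (anchor∈ a) (rotate c))

  -- The new element takes over when it equals `x` or lies strictly between the old anchor and `x`;
  -- otherwise the old anchor stays.
  anchor-step : ∀ {N x v} m → Anchor N x v → ∃[ w ] Anchor (m ∷ N) x w
  anchor-step {N} {x} {v} m a with v ≟ x | m ≟ x | m ≟ v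
  ... | yes refl | _        | _        = _ , mkAnchor (there (anchor∈ a)) (λ _ → irrefl₁₃) (λ _ → refl)
  ... | no _     | yes refl | _        = _ , mkAnchor (here refl) (λ _ → irrefl₁₃) (λ _ → refl)
  ... | no _     | no _     | yes refl = _ , mkAnchor (here refl)
    (λ { (here refl) → irrefl₁₂ ; (there z∈) → between a z∈ })
    (λ { (here refl) → refl ; (there x∈) → fixed a x∈ })
  ... | no v≢x   | no m≢x   | no m≢v with total (m≢v ∘ sym) m≢x v≢x
  ...   | inj₁ c = m , mkAnchor (here refl)
    (λ { (here refl) → irrefl₁₂
       ; (there z∈) d → between a z∈ (rotate (transitive (rotate (rotate c)) (rotate (rotate d)))) })
    (λ { (here refl) → refl ; (there x∈) → ⊥-elim (v≢x (fixed a x∈)) })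
  ...   | inj₂ c = v , mkAnchor (there (anchor∈ a))
    (λ { (here refl) → λ d → asym d c ; (there z∈) → between a z∈ })
    (λ { (here e) → ⊥-elim (m≢x (sym e)) ; (there x∈) → fixed a x∈ })

  anchor-exists : ∀ n ns x → ∃[ v ] Anchor (n ∷ ns) x v
  anchor-exists n []       x = n , mkAnchor (here refl)
    (λ { (here refl) → irrefl₁₂ }) (λ { (here e) → sym e })
  anchor-exists n (m ∷ ns) x with v , a ← anchor-exists m ns x = anchor-step n a

  -- Junk value 0 when N is empty.
  anchor : List ℕ → ℕ → ℕ
  anchor []       x = 0
  anchor (n ∷ ns) x = proj₁ (anchor-exists n ns x)

  anchor-Anchor : ∀ {N y} x → y ∈ N → Anchor N x (anchor N x)
  anchor-Anchor {n ∷ ns} x _ = proj₂ (anchor-exists n ns x)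

  -- The predecessor is the anchor of `y` once `y` itself is struck from `A`. The element `z` keeps
  -- the remaining set nonempty.
  predecessor : ∀ {A y z} → y ∈ A → z ∈ A → z ≢ y → ∃[ x ] (Succ A x y × x ≢ y)
  predecessor {A} {y} {z} y∈ z∈ z≢y = x , mkSucc x∈ y∈ gap′ (⊥-elim ∘ x≢y) , x≢y
    where
    N = filter (λ w → ¬? (w ≟ y)) A
    x = anchor N y
    a : Anchor N y x
    a = anchor-Anchor y (∈-filter⁺ (λ w → ¬? (w ≟ y)) z∈ z≢y)
    x∈ = proj₁ (∈-filter⁻ (λ w → ¬? (w ≟ y)) {xs = A} (anchor∈ a))
    x≢y = proj₂ (∈-filter⁻ (λ w → ¬? (w ≟ y)) {xs = A} (anchor∈ a))
    gap′ : ∀ {w} → w ∈ A → ¬ cyc x w y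
    gap′ {w} w∈ c with w ≟ y
    ... | yes refl = irrefl₂₃ c
    ... | no w≢y   = between a (∈-filter⁺ (λ w → ¬? (w ≟ y)) w∈ w≢y) c

  module _ {A N : List ℕ} (N⊆A : ∀ {z} → z ∈ N → z ∈ A) where

    -- The arc from `v` to `y` consists of the arc from `v` to `x`, the point `x` and the empty gap
    -- after `x`; and `x` can lie in `N` only if it is `v`.
    anchor-gap : ∀ {x y v} → Succ A x y → Anchor N x v → ∀ {z} → z ∈ N → ¬ cyc v z y
    anchor-gap {x} {y} {v} s a {z} z∈ c with v ≟ x | z ≟ x | x ≟ y
    ... | yes refl | _        | _        = gap s (N⊆A z∈) c
    ... | no v≢x   | yes refl | _        = v≢x (fixed a z∈)
    ... | no v≢x   | no _     | yes e    = v≢x (loop s e (N⊆A (anchor∈ a)))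
    ... | no v≢x   | no z≢x   | no _ with total v≢x (z≢x ∘ sym) (λ { refl → irrefl₁₂ c })
    ...   | inj₂ d = between a z∈ (rotate (rotate d))
    ...   | inj₁ d = gap s (N⊆A z∈) (rotate (rotate (transitive (rotate c) (rotate (rotate d)))))

    anchor-skip : ∀ {x y v} → Succ A x y → y ∉ N → Anchor N x v → Anchor N y v
    anchor-skip s y∉ a = mkAnchor (anchor∈ a) (anchor-gap s a) (⊥-elim ∘ y∉)

    -- Thinning `A` to `B` turns an anchor into a neighbour. This is how successors in the full
    -- support give successors in the support of a rest.
    anchor-Succ : ∀ {B x y v} → (∀ {z} → z ∈ B → z ∈ N) → Succ A x y → Anchor N x v →
      v ∈ B → y ∈ B → Succ B v y
    anchor-Succ {B} {x} {y} {v} B⊆N s a v∈ y∈ =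
      mkSucc v∈ y∈ (λ z∈ → anchor-gap s a (B⊆N z∈)) only
      where
      only : v ≡ y → ∀ {z} → z ∈ B → z ≡ v
      only refl {z} z∈ with v ≟ x | z ≟ v | z ≟ x
      ... | yes refl | _     | _        = loop s refl (N⊆A (B⊆N z∈))
      ... | no _     | yes e | _        = e
      ... | no v≢x   | no _  | yes refl = ⊥-elim (v≢x (fixed a (B⊆N z∈)))
      ... | no v≢x   | no z≢v | no z≢x with total (z≢v ∘ sym) z≢x v≢x
      ...   | inj₁ c = ⊥-elim (between a (B⊆N z∈) c)
      ...   | inj₂ c = ⊥-elim (gap s (N⊆A (B⊆N z∈)) c)

    -- All elements of `A` after `y`, up to and including `x`, lie outside `N`, and `s` is the first
    -- of them.
    anchor-Succ∉ : ∀ {x y s} → Anchor N x y → x ∈ A → x ∉ N → Succ A y s → s ∉ N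
    anchor-Succ∉ {x} {y} {s} a x∈ x∉ σ s∈ with s ≟ y | s ≟ x | x ≟ y
    ... | _        | _        | yes refl = x∉ (anchor∈ a)
    ... | _        | yes refl | no _     = x∉ s∈
    ... | yes refl | no _     | no x≢y   = x≢y (loop σ refl x∈)
    ... | no s≢y   | no s≢x   | no x≢y with total (s≢y ∘ sym) s≢x (x≢y ∘ sym)
    ...   | inj₁ c = between a s∈ c
    ...   | inj₂ c = gap σ x∈ (rotate (rotate c))

  module _ {A : List ℕ} {_~_ : ℕ → ℕ → Set}
           (~-refl : ∀ {x} → x ∈ A → x ~ x)
           (~-trans : ∀ {x y z} → x ~ y → y ~ z → x ~ z) where

    private
      Linked : ℕ → Set
      Linked z = ∃[ p ] (Succ A p z × p ~ z)

      -- Any list covering the elements strictly between v and x bounds the induction.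
      chain-acc : ∀ {v} → v ∈ A → ∀ L → Acc _<_ (length L) → ∀ {x} → x ∈ A →
        (∀ {z} → z ∈ A → cyc v z x → z ∈ L) →
        (∀ {z} → z ∈ A → cyc v z x ⊎ (z ≡ x × v ≢ x) → Linked z) → v ~ x
      chain-acc {v} v∈ L (acc rec) {x} x∈ cover linked with v ≟ x
      ... | yes refl = ~-refl v∈
      ... | no v≢x with p , s , p~x ← linked x∈ (inj₂ (refl , v≢x)) with v ≟ p
      ...   | yes refl = p~x
      ...   | no v≢p = ~-trans
        (chain-acc v∈ L′ (rec (filter-notAll P? L (lose (cover p∈ vpx) λ n → n refl))) p∈ cover′ linked′) p~x
        where
        P? = λ w → ¬? (w ≟ p)
        L′ = filter P? L
        p∈ = source∈ s
        p≢x : p ≢ x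
        p≢x e = v≢p (loop s e v∈)
        vpx : cyc v p x
        vpx with total v≢p p≢x v≢x
        ... | inj₁ c = c
        ... | inj₂ c = ⊥-elim (gap s v∈ (rotate c))
        cover′ : ∀ {z} → z ∈ A → cyc v z p → z ∈ L′
        cover′ z∈ c = ∈-filter⁺ P? (cover z∈ (transitive c vpx)) λ { refl → irrefl₂₃ c }
        linked′ : ∀ {z} → z ∈ A → cyc v z p ⊎ (z ≡ p × v ≢ p) → Linked z
        linked′ z∈ (inj₁ c)          = linked z∈ (inj₁ (transitive c vpx))
        linked′ z∈ (inj₂ (refl , _)) = linked z∈ (inj₁ vpx)

    -- Walks back from `x` to `v` along predecessors. Links are required on the half-open arc after
    -- `v` up to `x`; the clause `v ≢ x` makes that arc empty when the two ends coincide.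
    chain : ∀ {v x} → v ∈ A → x ∈ A →
      (∀ {z} → z ∈ A → cyc v z x ⊎ (z ≡ x × v ≢ x) → ∃[ p ] (Succ A p z × p ~ z)) → v ~ x
    chain v∈ x∈ = chain-acc v∈ A (<-wellFounded _) x∈ (λ z∈ _ → z∈)

    anchor-~ : ∀ {N x v} → (∀ {z} → z ∈ N → z ∈ A) → Anchor N x v → x ∈ A →
      (∀ {z} → z ∈ A → z ∉ N → ∃[ p ] (Succ A p z × p ~ z)) → v ~ x
    anchor-~ N⊆A a x∈ linked = chain (N⊆A (anchor∈ a)) x∈ λ
      { z∈ (inj₁ c)           → linked z∈ λ z∈N → between a z∈N c
      ; z∈ (inj₂ (refl , v≢)) → linked z∈ λ z∈N → v≢ (fixed a z∈N) }

-- The cyclic order of the integers and its opposite.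

Cyc : ℕ → ℕ → ℕ → Set
Cyc x y z = (x < y × y < z) ⊎ (y < z × z < x) ⊎ (z < x × x < y)

Cyc-isCyclicOrder : IsCyclicOrder Cyc
Cyc-isCyclicOrder = record { rotate = rotate ; asym = asym ; transitive = transitive ; total = total }
  where
  rotate : ∀ {x y z} → Cyc x y z → Cyc y z x
  rotate (inj₁ p)        = inj₂ (inj₂ p)
  rotate (inj₂ (inj₁ p)) = inj₁ p
  rotate (inj₂ (inj₂ p)) = inj₂ (inj₁ p)
  asym : ∀ {x y z} → Cyc x y z → ¬ Cyc z y x
  asym (inj₁ (p , q))        (inj₁ (r , s))        = <-asym p s
  asym (inj₁ (p , q))        (inj₂ (inj₁ (r , s))) = <-asym p r
  asym (inj₁ (p , q))        (inj₂ (inj₂ (r , s))) = <-asym q s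
  asym (inj₂ (inj₁ (p , q))) (inj₁ (r , s))        = <-asym p r
  asym (inj₂ (inj₁ (p , q))) (inj₂ (inj₁ (r , s))) = <-asym q s
  asym (inj₂ (inj₁ (p , q))) (inj₂ (inj₂ (r , s))) = <-asym p s
  asym (inj₂ (inj₂ (p , q))) (inj₁ (r , s))        = <-asym q s
  asym (inj₂ (inj₂ (p , q))) (inj₂ (inj₁ (r , s))) = <-asym p s
  asym (inj₂ (inj₂ (p , q))) (inj₂ (inj₂ (r , s))) = <-asym p r
  transitive : ∀ {x y z w} → Cyc x y z → Cyc x z w → Cyc x y w
  transitive (inj₁ (p , q))        (inj₁ (r , s))        = inj₁ (p , <-trans q s)
  transitive (inj₁ (p , q))        (inj₂ (inj₁ (r , s))) = ⊥-elim (<-asym (<-trans p q) (<-trans r s))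
  transitive (inj₁ (p , q))        (inj₂ (inj₂ (r , s))) = inj₂ (inj₂ (r , p))
  transitive (inj₂ (inj₁ (p , q))) (inj₁ (r , s))        = ⊥-elim (<-asym q r)
  transitive (inj₂ (inj₁ (p , q))) (inj₂ (inj₁ (r , s))) = inj₂ (inj₁ (<-trans p r , s))
  transitive (inj₂ (inj₁ (p , q))) (inj₂ (inj₂ (r , s))) = ⊥-elim (<-asym q s)
  transitive (inj₂ (inj₂ (p , q))) (inj₁ (r , s))        = ⊥-elim (<-asym p r)
  transitive (inj₂ (inj₂ (p , q))) (inj₂ (inj₁ (r , s))) = inj₂ (inj₂ (s , q))
  transitive (inj₂ (inj₂ (p , q))) (inj₂ (inj₂ (r , s))) = ⊥-elim (<-asym p s)
  total : ∀ {x y z} → x ≢ y → y ≢ z → x ≢ z → Cyc x y z ⊎ Cyc z y x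
  total {x} {y} {z} x≢y y≢z x≢z with <-cmp x y | <-cmp y z | <-cmp x z
  ... | tri≈ _ e _ | _ | _ = ⊥-elim (x≢y e)
  ... | _ | tri≈ _ e _ | _ = ⊥-elim (y≢z e)
  ... | _ | _ | tri≈ _ e _ = ⊥-elim (x≢z e)
  ... | tri< a _ _ | tri< b _ _ | _          = inj₁ (inj₁ (a , b))
  ... | tri< a _ _ | tri> _ _ b | tri< c _ _ = inj₂ (inj₂ (inj₂ (c , b)))
  ... | tri< a _ _ | tri> _ _ b | tri> _ _ c = inj₁ (inj₂ (inj₂ (c , a)))
  ... | tri> _ _ a | tri< b _ _ | tri< c _ _ = inj₂ (inj₂ (inj₁ (a , c)))
  ... | tri> _ _ a | tri< b _ _ | tri> _ _ c = inj₁ (inj₂ (inj₁ (b , c)))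
  ... | tri> _ _ a | tri> _ _ b | _          = inj₂ (inj₁ (b , a))

open Cyclic Cyc-isCyclicOrder
open Succ
module Backward = Cyclic (opposite Cyc-isCyclicOrder)

Succ⇒Backward : ∀ {A x y} → Succ A x y → Backward.Succ A y x
Succ⇒Backward (mkSucc x∈ y∈ g l) = Backward.mkSucc y∈ x∈ g λ { refl → l refl }

Backward⇒Succ : ∀ {A x y} → Backward.Succ A y x → Succ A x y
Backward⇒Succ (Backward.mkSucc y∈ x∈ g l) = mkSucc x∈ y∈ g λ { refl → l refl }

successor-Succ : ∀ {A x} → Increasing A → x ∈ A → Succ A x (successor A x)
successor-Succ {c ∷ cs} {x} inc x∈ with filterᵇ (λ b → x <ᵇ b) (c ∷ cs) in eq
... | b ∷ bs = mkSucc x∈ (proj₁ b∈×) gap′ λ { refl → ⊥-elim (<-irrefl refl x<b) }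
  where
  b∈× = ∈-filterᵇ⁻ (λ b → x <ᵇ b) {c ∷ cs} (subst (b ∈_) (sym eq) (here refl))
  x<b = <ᵇ⇒< x b (proj₂ b∈×)
  least : ∀ {z} → z ∈ c ∷ cs → x < z → ¬ z < b
  least {z} z∈ x<z z<b with subst (z ∈_) eq (∈-filterᵇ⁺ (λ b → x <ᵇ b) z∈ (<⇒<ᵇ x<z))
  ... | here refl = <-irrefl refl z<b
  ... | there z∈′ with b< ∷ _ ← subst Increasing eq (increasing-filterᵇ (λ b → x <ᵇ b) inc) =
    <-asym z<b (All.lookup b< z∈′)
  gap′ : ∀ {z} → z ∈ c ∷ cs → ¬ Cyc x z b
  gap′ z∈ (inj₁ (p , q))        = least z∈ p q
  gap′ z∈ (inj₂ (inj₁ (_ , q))) = <-asym q x<b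
  gap′ z∈ (inj₂ (inj₂ (p , _))) = <-asym p x<b
-- Nothing exceeds `x`, so the successor wraps round to the least element `c`. If this is `x` again,
-- then `x` is both greatest and least.
... | [] = mkSucc x∈ (here refl) gap′ loop′
  where
  greatest : ∀ {z} → z ∈ c ∷ cs → ¬ x < z
  greatest {z} z∈ x<z with () ← subst (z ∈_) eq (∈-filterᵇ⁺ (λ b → x <ᵇ b) z∈ (<⇒<ᵇ x<z))
  least : ∀ {z} → z ∈ c ∷ cs → ¬ z < c
  least (here refl) = <-irrefl refl
  least (there z∈) = <-asym (All.lookup (AllPairs.head inc) z∈)
  gap′ : ∀ {z} → z ∈ c ∷ cs → ¬ Cyc x z c
  gap′ z∈ (inj₁ (p , _))        = greatest z∈ p
  gap′ z∈ (inj₂ (inj₁ (p , _))) = least z∈ p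
  gap′ z∈ (inj₂ (inj₂ (_ , q))) = greatest z∈ q
  loop′ : x ≡ c → ∀ {z} → z ∈ c ∷ cs → z ≡ x
  loop′ refl z∈ = ≤-antisym (≮⇒≥ (greatest z∈)) (≮⇒≥ (least z∈))

-- Initiators, terminators and singletons as propositions.

-- On a one-element support the element is its own successor, so Init and Term hold of it,
-- as they should.
Init Term Sing : Partition → ℕ → Set
Init π x = ∃[ y ] (Succ (supp π) x y × SameBlock π x y)
Term π y = ∃[ x ] (Succ (supp π) x y × SameBlock π x y)
Sing π x = x ∈ supp π × (∀ {y} → SameBlock π x y → y ≡ x)

length≡1⁻ : ∀ {A : List ℕ} {x y} → T (length A ≡ᵇ 1) → x ∈ A → y ∈ A → x ≡ y
length≡1⁻ {_ ∷ []} _ (here refl) (here refl) = refl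

length≡1⁺ : ∀ {A : List ℕ} {x} → Unique A → x ∈ A → (∀ {y} → y ∈ A → y ≡ x) → T (length A ≡ᵇ 1)
length≡1⁺ {_ ∷ []}    _             _  _ = _
length≡1⁺ {_ ∷ _ ∷ _} ((n ∷ _) ∷ _) _  f = ⊥-elim (n (trans (f (here refl)) (sym (f (there (here refl))))))

module _ {π : Partition} (v : Valid π) where
  private
    A = supp π
    A-unique = increasing⇒unique (supp-increasing v)

  successor-supp : ∀ {x} → x ∈ A → Succ A x (successor A x)
  successor-supp = successor-Succ (supp-increasing v)

  isInitiator⁻ : ∀ {x} → x ∈ A → T (isInitiator π x) → Init π x
  isInitiator⁻ {x} x∈ t with Equivalence.to (T-∨ {length A ≡ᵇ 1}) t
  ... | inj₂ t′ = successor A x , successor-supp x∈ , sameBlock⁻ π (proj₂ (Equivalence.to (T-∧ {not (successor A x ≡ᵇ x)}) t′))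
  ... | inj₁ l  = successor A x , s , subst (SameBlock π x) (length≡1⁻ l x∈ (target∈ s)) (SameBlock-refl π x∈)
    where s = successor-supp x∈

  isInitiator⁺ : ∀ {x} → Init π x → T (isInitiator π x)
  isInitiator⁺ {x} (y , s , b) with refl ← Succ-unique s (successor-supp (source∈ s)) | x ≟ successor A x
  ... | yes e = Equivalence.from (T-∨ {length A ≡ᵇ 1}) (inj₁ (length≡1⁺ A-unique (source∈ s) (loop s e)))
  ... | no x≢ = Equivalence.from (T-∨ {length A ≡ᵇ 1}) (inj₂ (Equivalence.from T-∧
    (T-not⁺ (x≢ ∘ sym ∘ ≡ᵇ⇒≡ _ x) , sameBlock⁺ π b)))

  isTerminator⁻ : ∀ {y} → y ∈ A → T (isTerminator π y) → Term π y
  isTerminator⁻ {y} y∈ t with Equivalence.to (T-∨ {length A ≡ᵇ 1}) t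
  ... | inj₁ l = y , subst (Succ A y) (length≡1⁻ l (target∈ s) y∈) s , SameBlock-refl π y∈
    where s = successor-supp y∈
  ... | inj₂ t′ with x , x∈ , u ← any-elim _ {A} t′
    with _ , u′ ← Equivalence.to (T-∧ {not (successor A x ≡ᵇ x)} {sameBlock π x (successor A x) ∧ (successor A x ≡ᵇ y)}) u
    with b , e ← Equivalence.to (T-∧ {sameBlock π x (successor A x)} {successor A x ≡ᵇ y}) u′
    with refl ← ≡ᵇ⇒≡ (successor A x) y e = x , successor-supp x∈ , sameBlock⁻ π b

  isTerminator⁺ : ∀ {y} → Term π y → T (isTerminator π y)
  isTerminator⁺ {y} (x , s , b) with refl ← Succ-unique s (successor-supp (source∈ s)) | x ≟ successor A x
  ... | yes e = Equivalence.from (T-∨ {length A ≡ᵇ 1}) (inj₁ (length≡1⁺ A-unique (source∈ s) (loop s e)))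
  ... | no x≢ = Equivalence.from (T-∨ {length A ≡ᵇ 1}) (inj₂ (any-intro _ (source∈ s)
    (Equivalence.from T-∧ (T-not⁺ (x≢ ∘ sym ∘ ≡ᵇ⇒≡ _ x) ,
      Equivalence.from T-∧ (sameBlock⁺ π b , ≡⇒≡ᵇ (successor A x) (successor A x) refl)))))

  isSingleton⁻ : ∀ {x} → T (isSingleton π x) → Sing π x
  isSingleton⁻ {x} t with B , B∈ , u ← any-elim _ {π} t
    with l , x∈ᵇ ← Equivalence.to (T-∧ {length B ≡ᵇ 1}) u =
    SameBlock⇒∈ˡ (inBlock B∈ x∈ x∈) , alone
    where
    x∈ = ∈ᵇ⁻ x∈ᵇ
    alone : ∀ {y} → SameBlock π x y → y ≡ x
    alone (inBlock C∈ x∈′ y∈) with refl ← unique-concat⇒≡ (unique v) B∈ C∈ x∈ x∈′ = length≡1⁻ l y∈ x∈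

  isSingleton⁺ : ∀ {x} → Sing π x → T (isSingleton π x)
  isSingleton⁺ (x∈ , alone) with inBlock B∈ x∈B _ ← SameBlock-refl π x∈ =
    any-intro _ B∈ (Equivalence.from T-∧
      (length≡1⁺ (unique-concat⇒block (unique v) B∈) x∈B (λ y∈ → alone (inBlock B∈ x∈B y∈)) , ∈ᵇ⁺ x∈B))

-- Deletion of elements and the separation maps.

concat-filterᵇ-nonempty : ∀ (xss : List (List ℕ)) → concat (filterᵇ (not ∘ null) xss) ≡ concat xss
concat-filterᵇ-nonempty []               = refl
concat-filterᵇ-nonempty ([] ∷ xss)       = concat-filterᵇ-nonempty xss
concat-filterᵇ-nonempty ((x ∷ xs) ∷ xss) = cong ((x ∷ xs) ++_) (concat-filterᵇ-nonempty xss)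

concat-map-filterᵇ : ∀ p (xss : List (List ℕ)) → concat (map (filterᵇ p) xss) ≡ filterᵇ p (concat xss)
concat-map-filterᵇ p []         = refl
concat-map-filterᵇ p (xs ∷ xss) =
  trans (cong (filterᵇ p xs ++_) (concat-map-filterᵇ p xss)) (sym (filter-++ (T? ∘ p) xs (concat xss)))

module _ {π : Partition} (v : Valid π) (X : List ℕ) where
  private
    keep : ℕ → Bool
    keep y = not (y ∈ᵇ X)
    q = filterᵇ (not ∘ null) (map (filterᵇ keep) π)
    q-unique : Unique (concat q)
    q-unique = subst Unique (sym (trans (concat-filterᵇ-nonempty (map (filterᵇ keep) π)) (concat-map-filterᵇ keep π)))
      (Unique.filter⁺ (T? ∘ keep) (unique v))

  delete-valid : Valid (deleteElems X π)
  delete-valid = norm-valid {q} q-unique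

  SameBlock-delete⁻ : ∀ {x y} → SameBlock (deleteElems X π) x y → SameBlock π x y × x ∉ X
  SameBlock-delete⁻ s with inBlock B∈ x∈ y∈ ← SameBlock-norm⁻ {q} q-unique s
    with C , C∈ , refl ← ∈-map⁻ (filterᵇ keep) (proj₁ (∈-filterᵇ⁻ (not ∘ null) {map (filterᵇ keep) π} B∈))
    with x∈C , kx ← ∈-filterᵇ⁻ keep {C} x∈ | y∈C , _ ← ∈-filterᵇ⁻ keep {C} y∈ =
    inBlock C∈ x∈C y∈C , T-not⁻ kx ∘ ∈ᵇ⁺

  SameBlock-delete⁺ : ∀ {x y} → SameBlock π x y → x ∉ X → y ∉ X → SameBlock (deleteElems X π) x y
  SameBlock-delete⁺ (inBlock C∈ x∈ y∈) x∉ y∉ = SameBlock-norm⁺ {q} q-unique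
    (inBlock (∈-filterᵇ⁺ (not ∘ null) (∈-map⁺ (filterᵇ keep) C∈) (nonempty x∈′)) x∈′
             (∈-filterᵇ⁺ keep y∈ (T-not⁺ (y∉ ∘ ∈ᵇ⁻))))
    where
    x∈′ = ∈-filterᵇ⁺ keep x∈ (T-not⁺ (x∉ ∘ ∈ᵇ⁻))
    nonempty : ∀ {xs : List ℕ} {x} → x ∈ xs → T (not (null xs))
    nonempty {_ ∷ _} _ = _

-- What SeparateIS (for Adj = Init) and SeparateST (for Adj = Term) compute: π ↦ (ρ , (X , Y)).
record Separates (Adj : Partition → ℕ → Set) (π ρ : Partition) (X Y : List ℕ) : Set where
  field
    rest-valid   : Valid ρ
    X-increasing : Increasing X
    Y-increasing : Increasing Y
    X⁺           : ∀ {x} → Adj π x → x ∈ X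
    X⁻           : ∀ {x} → x ∈ X → Adj π x
    Y⁺           : ∀ {x} → Sing π x → x ∈ Y
    Y⁻           : ∀ {x} → x ∈ Y → Sing π x
    rest⁺        : ∀ {x y} → SameBlock π x y → x ∉ X → x ∉ Y → y ∉ X → y ∉ Y → SameBlock ρ x y
    rest⁻        : ∀ {x y} → SameBlock ρ x y → SameBlock π x y × x ∉ X × x ∉ Y

  rest-∈⁺ : ∀ {x} → x ∈ supp π → x ∉ X → x ∉ Y → x ∈ supp ρ
  rest-∈⁺ x∈ x∉X x∉Y = SameBlock⇒∈ˡ (rest⁺ (SameBlock-refl π x∈) x∉X x∉Y x∉X x∉Y)

  rest-∈⁻ : ∀ {x} → x ∈ supp ρ → x ∈ supp π × x ∉ X × x ∉ Y
  rest-∈⁻ x∈ with s , x∉X , x∉Y ← rest⁻ (SameBlock-refl ρ x∈) = SameBlock⇒∈ˡ s , x∉X , x∉Y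

  trichotomy : ∀ {x} → x ∈ supp π → x ∈ X ⊎ x ∈ Y ⊎ x ∈ supp ρ
  trichotomy {x} x∈ with x ∈? X | x ∈? Y
  ... | yes p | _     = inj₁ p
  ... | no _  | yes q = inj₂ (inj₁ q)
  ... | no p  | no q  = inj₂ (inj₂ (rest-∈⁺ x∈ p q))

open Separates

-- Makes `Separates` a complete specification: separations obtained by computation, by reflection or
-- by construction can be identified once they concern the same partition.
separates-determined : ∀ {Adj π ρ ρ′ X X′ Y Y′} → Separates Adj π ρ X Y → Separates Adj π ρ′ X′ Y′ →
  (ρ , (X , Y)) ≡ (ρ′ , (X′ , Y′))
separates-determined s t
  with refl ← increasing-ext (X-increasing s) (X-increasing t) (X⁺ t ∘ X⁻ s) (X⁺ s ∘ X⁻ t)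
     | refl ← increasing-ext (Y-increasing s) (Y-increasing t) (Y⁺ t ∘ Y⁻ s) (Y⁺ s ∘ Y⁻ t) =
  cong (_, _) (valid-ext (rest-valid s) (rest-valid t) (transfer s t) (transfer t s))
  where
  transfer : ∀ {Adj π ρ ρ′ X Y} → Separates Adj π ρ X Y → Separates Adj π ρ′ X Y →
    ∀ {x y} → SameBlock ρ x y → SameBlock ρ′ x y
  transfer s t b with b′ , x∉X , x∉Y ← rest⁻ s b | _ , y∉X , y∉Y ← rest⁻ s (SameBlock-sym b) =
    rest⁺ t b′ x∉X x∉Y y∉X y∉Y

singletons-increasing : ∀ {π} → Valid π → Increasing (singletons π)
singletons-increasing v = increasing-filterᵇ _ (supp-increasing v)

singletons⁺ : ∀ {π x} → Valid π → Sing π x → x ∈ singletons π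
singletons⁺ v s = ∈-filterᵇ⁺ _ (proj₁ s) (isSingleton⁺ v s)

singletons⁻ : ∀ {π x} → Valid π → x ∈ singletons π → Sing π x
singletons⁻ {π} v x∈ = isSingleton⁻ v (proj₂ (∈-filterᵇ⁻ (isSingleton π) {supp π} x∈))

deleteElems-Separates : ∀ {Adj π X} → Valid π → Increasing X →
  (∀ {x} → Adj π x → x ∈ X) → (∀ {x} → x ∈ X → Adj π x) →
  Separates Adj π (deleteElems (X ++ singletons π) π) X (singletons π)
deleteElems-Separates {π = π} {X} v inc f g = record
  { rest-valid   = delete-valid v (X ++ singletons π)
  ; X-increasing = inc
  ; Y-increasing = singletons-increasing v
  ; X⁺ = f
  ; X⁻ = g
  ; Y⁺ = singletons⁺ v
  ; Y⁻ = singletons⁻ v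
  ; rest⁺ = λ b x∉X x∉Y y∉X y∉Y → SameBlock-delete⁺ v (X ++ singletons π) b (neither x∉X x∉Y) (neither y∉X y∉Y)
  ; rest⁻ = λ b → let b′ , x∉ = SameBlock-delete⁻ v (X ++ singletons π) b in b′ , x∉ ∘ ∈-++⁺ˡ , x∉ ∘ ∈-++⁺ʳ X
  }
  where
  neither : ∀ {x Y} → x ∉ X → x ∉ Y → x ∉ X ++ Y
  neither p q x∈ with ∈-++⁻ X x∈
  ... | inj₁ x∈X = p x∈X
  ... | inj₂ x∈Y = q x∈Y

SeparateIS-Separates : ∀ {π} → Valid π →
  Separates Init π (proj₁ (SeparateIS π)) (initiators π) (singletons π)
SeparateIS-Separates {π} v = deleteElems-Separates v (increasing-filterᵇ _ (supp-increasing v))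
  (λ i → ∈-filterᵇ⁺ _ (source∈ (proj₁ (proj₂ i))) (isInitiator⁺ v i))
  (λ x∈ → let x∈A , t = ∈-filterᵇ⁻ (isInitiator π) {supp π} x∈ in isInitiator⁻ v x∈A t)

SeparateST-Separates : ∀ {π} → Valid π →
  Separates Term π (proj₁ (SeparateST π)) (terminators π) (singletons π)
SeparateST-Separates {π} v = deleteElems-Separates v (increasing-filterᵇ _ (supp-increasing v))
  (λ i → ∈-filterᵇ⁺ _ (target∈ (proj₁ (proj₂ i))) (isTerminator⁺ v i))
  (λ x∈ → let x∈A , t = ∈-filterᵇ⁻ (isTerminator π) {supp π} x∈ in isTerminator⁻ v x∈A t)

-- Enumeration of set partitions and the search behind `CombineST`.

insertions-↭ : ∀ {x p p′} → p′ ∈ insertions x p → concat p′ ↭ x ∷ concat p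
insertions-↭ {x} {B ∷ p} (here refl) = ↭-refl
insertions-↭ {x} {B ∷ p} (there p′∈) with p″ , p″∈ , refl ← ∈-map⁻ (B ∷_) p′∈ =
  ↭-trans (++⁺ˡ B (insertions-↭ {x} {p} p″∈)) (shift x B (concat p))

allPartitions-↭ : ∀ A {p} → p ∈ allPartitions A → concat p ↭ A
allPartitions-↭ []      (here refl) = ↭-refl
allPartitions-↭ (x ∷ A) p∈ with q , q∈ , p∈′ ← find (∈-concatMap⁻ _ {xs = allPartitions A} p∈) | p∈′
... | here refl = prep x (allPartitions-↭ A q∈)
... | there i   = ↭-trans (insertions-↭ {x} {q} i) (prep x (allPartitions-↭ A q∈))

unique-↭ : ∀ {xs ys : List ℕ} → xs ↭ ys → Unique xs → Unique ys
unique-↭ p = Permutationₛ.Unique-resp-↭ (setoid ℕ) (↭⇒↭ₛ p)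

insertion : ∀ x {B p} → B ∈ p → ∃[ p′ ] (p′ ∈ insertions x p × (x ∷ B) ∈ p′
  × (∀ {C} → C ∈ p → C ≡ B ⊎ C ∈ p′) × (∀ {C} → C ∈ p′ → C ≡ x ∷ B ⊎ C ∈ p))
insertion x {B} {_ ∷ p} (here refl) = (x ∷ B) ∷ p , here refl , here refl ,
  (λ { (here e) → inj₁ e ; (there C∈) → inj₂ (there C∈) }) ,
  (λ { (here e) → inj₁ e ; (there C∈) → inj₂ (there C∈) })
insertion x {B} {D ∷ p} (there B∈) with p′ , i , xB∈ , f , g ← insertion x B∈ =
  D ∷ p′ , there (∈-map⁺ (D ∷_) i) , there xB∈ ,
  (λ { (here e) → inj₂ (here e) ; (there C∈) → map₂ there (f C∈) }) ,
  (λ { (here e) → inj₂ (here e) ; (there C∈) → map₂ there (g C∈) })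

-- The enumeration lists blocks and elements in an order of its own, so a partition is matched only
-- through the relation it induces; `norm` restores literal equality afterwards.
record Realises (r : ℕ → ℕ → Bool) (A : List ℕ) (p : Partition) : Set where
  field
    member : p ∈ allPartitions A
    sound  : ∀ {x y} → SameBlock p x y → x ∈ A × T (r x y)
    full   : ∀ {x y} → x ∈ A → y ∈ A → T (r x y) → SameBlock p x y

open Realises

module _ {r : ℕ → ℕ → Bool}
         (symm : ∀ {x y} → T (r x y) → T (r y x))
         (tran : ∀ {x y z} → T (r x y) → T (r y z) → T (r x z)) where

  -- Induction on the ground set: a new element opens its own block if it is related to none of the
  -- others, and otherwise enters the block of any `y` related to it.
  allPartitions-complete : ∀ A → Unique A → (∀ {x} → x ∈ A → T (r x x)) → ∃ (Realises r A)
  allPartitions-complete [] _ _ = [] , record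
    { member = here refl ; sound = λ { (inBlock () _ _) } ; full = λ () }
  allPartitions-complete (x ∷ A) (x∉ ∷ u) rfl
    with p , R ← allPartitions-complete A u (rfl ∘ there) | Any.any? (λ y → T? (r x y)) A
  ... | no none = [ x ] ∷ p , record
    { member = ∈-concatMap⁺ _ (lose (member R) (here refl))
    ; sound = λ
        { (inBlock (here refl) (here refl) (here refl)) → here refl , rfl (here refl)
        ; (inBlock (there C∈) a∈ b∈) → let a∈A , rab = sound R (inBlock C∈ a∈ b∈) in there a∈A , rab }
    ; full = λ
        { (here refl) (here refl) _ → inBlock (here refl) (here refl) (here refl)
        ; (here refl) (there b∈) s → ⊥-elim (none (lose b∈ s))
        ; (there a∈) (here refl) s → ⊥-elim (none (lose a∈ (symm s)))
        ; (there a∈) (there b∈) s → weaken (full R a∈ b∈ s) }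
    }
    where
    weaken : ∀ {B a b} → SameBlock p a b → SameBlock (B ∷ p) a b
    weaken (inBlock C∈ a∈ b∈) = inBlock (there C∈) a∈ b∈
  ... | yes some with y , y∈ , rxy ← find some with full R y∈ y∈ (rfl (there y∈))
  ...   | inBlock {B} B∈ y∈B _ with p′ , i , xB∈ , f , g ← insertion x B∈ = p′ , record
    { member = ∈-concatMap⁺ _ (lose (member R) (there i)) ; sound = sound′ ; full = full′ }
    where
    p-unique : Unique (concat p)
    p-unique = unique-↭ (↭-sym (allPartitions-↭ A (member R))) u
    -- Together with `inB`: the enlarged block is exactly the class of `y`.
    near : ∀ {c} → c ∈ x ∷ B → c ∈ x ∷ A × T (r y c)
    near (here refl) = here refl , symm rxy
    near (there c∈)  =
      let c∈A , rcy = sound R (inBlock B∈ c∈ y∈B) in there c∈A , symm rcy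
    inB : ∀ {c} → c ∈ x ∷ A → T (r y c) → c ∈ x ∷ B
    inB (here refl) _ = here refl
    inB (there c∈) ryc with inBlock C∈ y∈C c∈C ← full R y∈ c∈ ryc
      with refl ← unique-concat⇒≡ p-unique B∈ C∈ y∈B y∈C = there c∈C
    sound′ : ∀ {a b} → SameBlock p′ a b → a ∈ x ∷ A × T (r a b)
    sound′ (inBlock C∈ a∈ b∈) with g C∈
    ... | inj₁ refl = proj₁ (near a∈) , tran (symm (proj₂ (near a∈))) (proj₂ (near b∈))
    ... | inj₂ C∈p  = let a∈A , rab = sound R (inBlock C∈p a∈ b∈) in there a∈A , rab
    full′ : ∀ {a b} → a ∈ x ∷ A → b ∈ x ∷ A → T (r a b) → SameBlock p′ a b
    full′ {a} a∈ b∈ rab with T? (r y a)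
    ... | yes rya = inBlock xB∈ (inB a∈ rya) (inB b∈ (tran rya rab))
    full′ (here refl) _ _ | no n = ⊥-elim (n (symm rxy))
    full′ (there _) (here refl) rab | no n = ⊥-elim (n (symm (tran rab rxy)))
    full′ (there a∈) (there b∈) rab | no n with inBlock C∈ a∈C b∈C ← full R a∈ b∈ rab with f C∈
    ... | inj₁ refl = ⊥-elim (n (proj₂ (near (there a∈C))))
    ... | inj₂ C∈p′ = inBlock C∈p′ a∈C b∈C

valid∈candidates : ∀ {π} → Valid π → π ∈ map norm (allPartitions (supp π))
valid∈candidates {π} v
  with E ← sameBlock-equivalence π (unique v) | u ← increasing⇒unique (supp-increasing v)
  with p , R ← allPartitions-complete (λ {x y} → EquivalenceOn.symm E {x} {y})
                 (λ {x y z} → EquivalenceOn.tran E {x} {y} {z}) (supp π) u (EquivalenceOn.refl-on E) =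
  subst (_∈ map norm (allPartitions (supp π)))
    (trans (norm-ext (unique-↭ (↭-sym (allPartitions-↭ (supp π) (member R))) u) (unique v)
             (λ {x} {y} b → sameBlock⁻ π {x} {y} (proj₂ (sound R b)))
             (λ b → full R (SameBlock⇒∈ˡ b) (SameBlock⇒∈ʳ b) (sameBlock⁺ π b)))
           (canonical v))
    (∈-map⁺ norm (member R))

-- The search may stop before it reaches `c`, so only membership and `P` are claimed for its result.
firstWith-finds : ∀ {P : Partition → Set} (P? : ∀ c → Dec (P c)) {d cs c} → c ∈ cs → P c →
  firstWith (λ c → does (P? c)) d cs ∈ cs × P (firstWith (λ c → does (P? c)) d cs)
firstWith-finds P? {cs = b ∷ cs} c∈ pc with P? b
... | yes pb = here refl , pb
... | no ¬pb with c∈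
...   | here refl = ⊥-elim (¬pb pc)
...   | there c∈′ with m , p ← firstWith-finds P? {cs = cs} c∈′ pc = there m , p

separatesTo? : ∀ τXY c → Dec (SeparateST c ≡ τXY)
separatesTo? τXY c = ×-≡-dec (≡-dec (≡-dec _≟_)) (×-≡-dec (≡-dec _≟_) (≡-dec _≟_)) (SeparateST c) τXY

ground : Partition → List ℕ → List ℕ → List ℕ
ground τ X Y = sort (deduplicateᵇ _≡ᵇ_ (concat τ ++ X ++ Y))

-- `decP` is private to the definitions; `separatesTo?` repeats its body, so the two searches agree
-- by computation.
CombineST-search : ∀ τ X Y → CombineST τ (X , Y) ≡
  firstWith (λ c → does (separatesTo? (τ , (X , Y)) c)) τ (map norm (allPartitions (ground τ X Y)))
CombineST-search τ X Y = refl

CombineST-finds : ∀ {c τ X Y} → c ∈ map norm (allPartitions (ground τ X Y)) →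
  SeparateST c ≡ (τ , (X , Y)) →
  Valid (CombineST τ (X , Y)) × SeparateST (CombineST τ (X , Y)) ≡ (τ , (X , Y))
CombineST-finds {c} {τ} {X} {Y} c∈ e = subst (λ d → Valid d × SeparateST d ≡ (τ , (X , Y)))
  (sym (CombineST-search τ X Y))
  (let m , e′ = firstWith-finds {P = λ c → SeparateST c ≡ (τ , (X , Y))} (separatesTo? (τ , (X , Y))) {τ} c∈ e
   in candidate-valid m , e′)
  where
  candidate-valid : ∀ {d} → d ∈ map norm (allPartitions (ground τ X Y)) → Valid d
  candidate-valid d∈ with p , p∈ , refl ← ∈-map⁻ norm d∈ =
    norm-valid {p} (unique-↭ (↭-sym (allPartitions-↭ (ground τ X Y) p∈))
      (increasing⇒unique (sort-increasing (dedup-unique (concat τ ++ X ++ Y)))))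

Separates-supp : ∀ {c τ X Y} → Valid c → Separates Term c τ X Y → ground τ X Y ≡ supp c
Separates-supp {c} {τ} {X} {Y} v s =
  increasing-ext (sort-increasing (dedup-unique L)) (supp-increasing v) to from
  where
  L = concat τ ++ X ++ Y
  to : ∀ {z} → z ∈ ground τ X Y → z ∈ supp c
  to z∈ with ∈-++⁻ (concat τ) (∈-dedup⁻ L (∈-sort⁻ z∈))
  ... | inj₁ z∈τ = proj₁ (rest-∈⁻ s (∈-sort⁺ z∈τ))
  ... | inj₂ z∈XY with ∈-++⁻ X z∈XY
  ...   | inj₁ z∈X = target∈ (proj₁ (proj₂ (X⁻ s z∈X)))
  ...   | inj₂ z∈Y = proj₁ (Y⁻ s z∈Y)
  from : ∀ {z} → z ∈ supp c → z ∈ ground τ X Y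
  from {z} z∈ = ∈-sort⁺ (∈-dedup⁺ L (place (trichotomy s z∈)))
    where
    place : z ∈ X ⊎ z ∈ Y ⊎ z ∈ supp τ → z ∈ L
    place (inj₁ z∈X)        = ∈-++⁺ʳ (concat τ) (∈-++⁺ˡ z∈X)
    place (inj₂ (inj₁ z∈Y)) = ∈-++⁺ʳ (concat τ) (∈-++⁺ʳ X z∈Y)
    place (inj₂ (inj₂ z∈τ)) = ∈-++⁺ˡ (∈-sort⁻ {concat τ} z∈τ)

SeparateST≡⇒Separates : ∀ {d τ X Y} → Valid d → SeparateST d ≡ (τ , (X , Y)) → Separates Term d τ X Y
SeparateST≡⇒Separates v refl = SeparateST-Separates v

-- Any preimage `c` is itself among the candidates, so the search succeeds and the default value
-- never appears.
CombineST-Separates : ∀ {c τ X Y} → Valid c → Separates Term c τ X Y →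
  Valid (CombineST τ (X , Y)) × Separates Term (CombineST τ (X , Y)) τ X Y
CombineST-Separates {c} {τ} {X} {Y} v s =
  let d-valid , e = CombineST-finds {c} {τ} {X} {Y}
        (subst (λ A → c ∈ map norm (allPartitions A)) (sym (Separates-supp v s)) (valid∈candidates v))
        (separates-determined (SeparateST-Separates v) s)
  in d-valid , SeparateST≡⇒Separates d-valid e

-- Reflection of partitions.

module Complement (n : ℕ) where

  reflect : ℕ → ℕ
  reflect x = suc n ∸ x

  -- Truncated subtraction sends everything beyond `suc n` to 0, so `reflect` is invertible and
  -- order-reversing only on a bounded range.
  Bounded : ℕ → Set
  Bounded x = 1 ≤ x × x ≤ n

  reflect-bounded : ∀ {x} → Bounded x → Bounded (reflect x)
  reflect-bounded {suc x} (_ , x≤n) = m<n⇒0<n∸m x≤n , m∸n≤m n x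

  reflect-involutive : ∀ {x} → Bounded x → reflect (reflect x) ≡ x
  reflect-involutive (_ , x≤n) = m∸[m∸n]≡n (m≤n⇒m≤1+n x≤n)

  reflect-injective : ∀ {x y} → Bounded x → Bounded y → reflect x ≡ reflect y → x ≡ y
  reflect-injective bx by e =
    trans (sym (reflect-involutive bx)) (trans (cong reflect e) (reflect-involutive by))

  reflect-< : ∀ {x y} → Bounded y → x < y → reflect y < reflect x
  reflect-< (_ , y≤n) x<y = ∸-monoʳ-< x<y (m≤n⇒m≤1+n y≤n)

  reflect-Cyc : ∀ {x y z} → Bounded x → Bounded y → Bounded z → Cyc x y z →
    Cyc (reflect z) (reflect y) (reflect x)
  reflect-Cyc bx by bz (inj₁ (p , q))        = inj₁ (reflect-< bz q , reflect-< by p)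
  reflect-Cyc bx by bz (inj₂ (inj₁ (p , q))) = inj₂ (inj₂ (reflect-< bx q , reflect-< bz p))
  reflect-Cyc bx by bz (inj₂ (inj₂ (p , q))) = inj₂ (inj₁ (reflect-< by q , reflect-< bx p))

  -- A symmetric relation in place of the map `complement`: facts proved in one direction are read
  -- in the other through `mirror-sym`.
  record Mirror (π π′ : Partition) : Set where
    field
      valid    : Valid π
      valid′   : Valid π′
      bounded  : ∀ {x} → x ∈ supp π → Bounded x
      bounded′ : ∀ {x} → x ∈ supp π′ → Bounded x
      block    : ∀ {x y} → SameBlock π x y → SameBlock π′ (reflect x) (reflect y)
      block′   : ∀ {x y} → SameBlock π′ x y → SameBlock π (reflect x) (reflect y)

    supp⁺ : ∀ {x} → x ∈ supp π → reflect x ∈ supp π′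
    supp⁺ x∈ = SameBlock⇒∈ˡ (block (SameBlock-refl π x∈))

  open Mirror

  mirror-sym : ∀ {π π′} → Mirror π π′ → Mirror π′ π
  mirror-sym m = record
    { valid = valid′ m ; valid′ = valid m ; bounded = bounded′ m ; bounded′ = bounded m
    ; block = block′ m ; block′ = block m }

  mirror-unique : ∀ {π ρ σ} → Mirror π ρ → Mirror π σ → ρ ≡ σ
  mirror-unique m k = valid-ext (valid′ m) (valid′ k) (transfer m k) (transfer k m)
    where
    transfer : ∀ {π ρ σ} → Mirror π ρ → Mirror π σ → ∀ {x y} → SameBlock ρ x y → SameBlock σ x y
    transfer m k b = subst₂ (SameBlock _)
      (reflect-involutive (bounded′ m (SameBlock⇒∈ˡ b))) (reflect-involutive (bounded′ m (SameBlock⇒∈ʳ b)))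
      (block k (block′ m b))

  mirror-Succ : ∀ {π π′} → Mirror π π′ → ∀ {x y} → Succ (supp π) x y →
    Succ (supp π′) (reflect y) (reflect x)
  mirror-Succ {π} {π′} m {x} {y} s = mkSucc (supp⁺ m (target∈ s)) (supp⁺ m (source∈ s)) gap′ loop′
    where
    bx = bounded m (source∈ s)
    by = bounded m (target∈ s)
    gap′ : ∀ {z} → z ∈ supp π′ → ¬ Cyc (reflect y) z (reflect x)
    gap′ {z} z∈ c = gap s (supp⁺ (mirror-sym m) z∈)
      (subst₂ (λ u w → Cyc u (reflect z) w) (reflect-involutive bx) (reflect-involutive by)
        (reflect-Cyc (reflect-bounded by) (bounded′ m z∈) (reflect-bounded bx) c))
    loop′ : reflect y ≡ reflect x → ∀ {z} → z ∈ supp π′ → z ≡ reflect y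
    loop′ e z∈ = trans (sym (reflect-involutive (bounded′ m z∈)))
      (trans (cong reflect (loop s (sym (reflect-injective by bx e)) (supp⁺ (mirror-sym m) z∈))) (sym e))

  mirror-Init : ∀ {π π′} → Mirror π π′ → ∀ {x} → Init π x → Term π′ (reflect x)
  mirror-Init m (y , s , b) = reflect y , mirror-Succ m s , SameBlock-sym (block m b)

  mirror-Term : ∀ {π π′} → Mirror π π′ → ∀ {x} → Term π x → Init π′ (reflect x)
  mirror-Term m (y , s , b) = reflect y , mirror-Succ m s , SameBlock-sym (block m b)

  mirror-Sing : ∀ {π π′} → Mirror π π′ → ∀ {x} → Sing π x → Sing π′ (reflect x)
  mirror-Sing {π} {π′} m {x} (x∈ , alone) = supp⁺ m x∈ , alone′
    where
    alone′ : ∀ {y} → SameBlock π′ (reflect x) y → y ≡ reflect x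
    alone′ {y} b = trans (sym (reflect-involutive (bounded′ m (SameBlock⇒∈ʳ b))))
      (cong reflect (alone (subst (λ u → SameBlock π u (reflect y)) (reflect-involutive (bounded m x∈))
        (block′ m b))))

  complement-unique : ∀ {π} → Valid π → (∀ {x} → x ∈ supp π → Bounded x) →
    Unique (concat (map (map reflect) π))
  complement-unique {π} v bd = subst Unique (sym (concat-map π)) (AllPairs.map⁺
    (AllPairs-mapLocal (λ x∈ y∈ x≢y e → x≢y (reflect-injective (bd (∈-sort⁺ x∈)) (bd (∈-sort⁺ y∈)) e))
      (unique v)))

  complement-nonempty : ∀ {π} → Valid π → (∀ {x} → x ∈ supp π → Bounded x) →
    All (λ B → null B ≡ false) (complement n π)
  complement-nonempty {π} v bd = norm-nonempty {map (map (λ x → suc n ∸ x)) π} (complement-unique v bd)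

  SameBlock-map⁻ : ∀ {π x y} → SameBlock (map (map reflect) π) x y →
    ∃[ a ] ∃[ b ] (SameBlock π a b × x ≡ reflect a × y ≡ reflect b)
  SameBlock-map⁻ (inBlock B∈ x∈ y∈) with C , C∈ , refl ← ∈-map⁻ (map reflect) B∈
    with a , a∈ , refl ← ∈-map⁻ reflect x∈ | b , b∈ , refl ← ∈-map⁻ reflect y∈ =
    a , b , inBlock C∈ a∈ b∈ , refl , refl

  complement-Mirror : ∀ {π} → Valid π → (∀ {x} → x ∈ supp π → Bounded x) → Mirror π (complement n π)
  complement-Mirror {π} v bd = record
    { valid    = v
    ; valid′   = norm-valid {q} u
    ; bounded  = bd
    ; bounded′ = λ x∈ → bounded-map (SameBlock-norm⁻ {q} u (SameBlock-refl (norm q) x∈))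
    ; block    = λ { (inBlock B∈ x∈ y∈) →
        SameBlock-norm⁺ {q} u (inBlock (∈-map⁺ (map reflect) B∈) (∈-map⁺ reflect x∈) (∈-map⁺ reflect y∈)) }
    ; block′   = λ s → block-map (SameBlock-norm⁻ {q} u s) }
    where
    q = map (map (λ x → suc n ∸ x)) π
    u : Unique (concat q)
    u = complement-unique v bd
    bounded-map : ∀ {x} → SameBlock q x x → Bounded x
    bounded-map s with a , _ , t , refl , _ ← SameBlock-map⁻ s = reflect-bounded (bd (SameBlock⇒∈ˡ t))
    block-map : ∀ {x y} → SameBlock q x y → SameBlock π (reflect x) (reflect y)
    block-map s with a , b , t , refl , refl ← SameBlock-map⁻ s =
      subst₂ (SameBlock π) (sym (reflect-involutive (bd (SameBlock⇒∈ˡ t))))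
        (sym (reflect-involutive (bd (SameBlock⇒∈ʳ t)))) t

  reflectSet : List ℕ → List ℕ
  reflectSet X = sort (map reflect X)

  module _ {Adj Adj′ : Partition → ℕ → Set}
           (adj  : ∀ {π π′} → Mirror π π′ → ∀ {x} → Adj π x → Adj′ π′ (reflect x))
           (adj′ : ∀ {π π′} → Mirror π π′ → ∀ {x} → Adj′ π x → Adj π′ (reflect x))
           (adj-supp  : ∀ {π x} → Adj π x → x ∈ supp π)
           (adj-supp′ : ∀ {π x} → Adj′ π x → x ∈ supp π) where

    private
      reflectSet-increasing : ∀ {X} → Increasing X → (∀ {x} → x ∈ X → Bounded x) → Increasing (reflectSet X)
      reflectSet-increasing inc bd = sort-increasing (AllPairs.map⁺
        (AllPairs-mapLocal (λ x∈ y∈ x≢y e → x≢y (reflect-injective (bd x∈) (bd y∈) e)) (increasing⇒unique inc)))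

      ∈-reflectSet⁺ : ∀ {X x} → Bounded x → reflect x ∈ X → x ∈ reflectSet X
      ∈-reflectSet⁺ {X} b x∈ = ∈-sort⁺ (subst (_∈ map reflect X) (reflect-involutive b) (∈-map⁺ reflect x∈))

      ∈-reflectSet⁻ : ∀ X {x} → (∀ {y} → y ∈ X → Bounded y) → x ∈ reflectSet X → reflect x ∈ X
      ∈-reflectSet⁻ X bd x∈ with y , y∈ , refl ← ∈-map⁻ reflect (∈-sort⁻ {map reflect X} x∈) =
        subst (_∈ X) (sym (reflect-involutive (bd y∈))) y∈

    -- Parametric in `Adj` and `Adj′`, since a mirrored chain needs it both from `Init` to `Term`
    -- and from `Term` to `Init`.
    mirror-Separates : ∀ {π π′ ρ ρ′ X Y} → Mirror π π′ → Mirror ρ ρ′ → Separates Adj π ρ X Y →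
      Separates Adj′ π′ ρ′ (reflectSet X) (reflectSet Y)
    mirror-Separates {π} {π′} {ρ} {ρ′} {X} {Y} m k s = record
      { rest-valid   = valid′ k
      ; X-increasing = reflectSet-increasing (X-increasing s) bX
      ; Y-increasing = reflectSet-increasing (Y-increasing s) bY
      ; X⁺ = λ a → ∈-reflectSet⁺ (bounded′ m (adj-supp′ a)) (X⁺ s (adj′ (mirror-sym m) a))
      ; X⁻ = λ x∈ → back {Adj′} (bx x∈) (adj m (X⁻ s (∈-reflectSet⁻ X bX x∈)))
      ; Y⁺ = λ a → ∈-reflectSet⁺ (bounded′ m (proj₁ a)) (Y⁺ s (mirror-Sing (mirror-sym m) a))
      ; Y⁻ = λ x∈ → back {Sing} (by x∈) (mirror-Sing m (Y⁻ s (∈-reflectSet⁻ Y bY x∈)))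
      ; rest⁺ = λ b x∉X x∉Y y∉X y∉Y →
          let bdx = bounded′ m (SameBlock⇒∈ˡ b) ; bdy = bounded′ m (SameBlock⇒∈ʳ b) in
          subst₂ (SameBlock ρ′) (reflect-involutive bdx) (reflect-involutive bdy)
            (block k (rest⁺ s (block′ m b)
              (x∉X ∘ ∈-reflectSet⁺ bdx) (x∉Y ∘ ∈-reflectSet⁺ bdx) (y∉X ∘ ∈-reflectSet⁺ bdy) (y∉Y ∘ ∈-reflectSet⁺ bdy)))
      ; rest⁻ = λ b →
          let t , x∉X , x∉Y = rest⁻ s (block′ k b) in
          subst₂ (SameBlock π′) (reflect-involutive (bounded′ k (SameBlock⇒∈ˡ b)))
            (reflect-involutive (bounded′ k (SameBlock⇒∈ʳ b))) (block m t)
          , x∉X ∘ ∈-reflectSet⁻ X bX , x∉Y ∘ ∈-reflectSet⁻ Y bY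
      }
      where
      bX : ∀ {x} → x ∈ X → Bounded x
      bX x∈ = bounded m (adj-supp (X⁻ s x∈))
      bY : ∀ {x} → x ∈ Y → Bounded x
      bY x∈ = bounded m (proj₁ (Y⁻ s x∈))
      bx : ∀ {x} → x ∈ reflectSet X → Bounded x
      bx x∈ with y , y∈ , refl ← ∈-map⁻ reflect (∈-sort⁻ {map reflect X} x∈) = reflect-bounded (bX y∈)
      by : ∀ {x} → x ∈ reflectSet Y → Bounded x
      by x∈ with y , y∈ , refl ← ∈-map⁻ reflect (∈-sort⁻ {map reflect Y} x∈) = reflect-bounded (bY y∈)
      back : ∀ {P : Partition → ℕ → Set} {x} → Bounded x → P π′ (reflect (reflect x)) → P π′ x
      back {P} b = subst (P π′) (reflect-involutive b)

-- Injectivity of `SeparateST`.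

open Anchor

Term-supp : ∀ {π x} → Term π x → x ∈ supp π
Term-supp (_ , s , _) = target∈ s

Init-supp : ∀ {π x} → Init π x → x ∈ supp π
Init-supp (_ , s , _) = source∈ s

complementIn : List ℕ → List ℕ → List ℕ
complementIn A X = filter (λ z → ¬? (z ∈? X)) A

∈-complementIn⁺ : ∀ {A X z} → z ∈ A → z ∉ X → z ∈ complementIn A X
∈-complementIn⁺ {X = X} = ∈-filter⁺ (λ z → ¬? (z ∈? X))

∈-complementIn⁻ : ∀ A X {z} → z ∈ complementIn A X → z ∈ A × z ∉ X
∈-complementIn⁻ A X = ∈-filter⁻ (λ z → ¬? (z ∈? X)) {xs = A}

∉-complementIn : ∀ {A X z} → z ∈ A → z ∉ complementIn A X → z ∈ X
∉-complementIn {A} {X} {z} z∈ z∉ with z ∈? X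
... | yes z∈X = z∈X
... | no z∉X  = ⊥-elim (z∉ (∈-complementIn⁺ z∈ z∉X))

separates-⊆ : ∀ {π π′ ρ X Y} → Separates Term π ρ X Y → Separates Term π′ ρ X Y →
  ∀ {z} → z ∈ supp π → z ∈ supp π′
separates-⊆ s t z∈ with trichotomy s z∈
... | inj₁ z∈X        = Term-supp (X⁻ t z∈X)
... | inj₂ (inj₁ z∈Y) = proj₁ (Y⁻ t z∈Y)
... | inj₂ (inj₂ z∈ρ) = proj₁ (rest-∈⁻ t z∈ρ)

-- Blocks are recovered from (ρ, T, S): every element lies in the block of its
-- anchor outside T, and two distinct anchors in one block both survive in ρ.
SeparateST-reflects-SameBlock : ∀ {π π′ ρ X Y} → Valid π → Valid π′ →
  Separates Term π ρ X Y → Separates Term π′ ρ X Y →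
  ∀ {x y} → SameBlock π x y → SameBlock π′ x y
SeparateST-reflects-SameBlock {π} {π′} {ρ} {X} {Y} v v′ s t {x} {y} b
  with Any.any? (λ z → ¬? (z ∈? X)) (supp π)
-- Every element is a terminator, so there are no anchors; the walk from `y` back to `x` passes
-- through terminators only.
... | no all∈X = chain (SameBlock-refl π′) (SameBlock-trans (unique v′))
    (separates-⊆ s t (SameBlock⇒∈ˡ b)) (separates-⊆ s t (SameBlock⇒∈ʳ b)) linked
  where
  linked : ∀ {z} → z ∈ supp π′ → Cyc x z y ⊎ (z ≡ y × x ≢ y) → Term π′ z
  linked {z} z∈ _ with z ∈? X
  ... | yes z∈X = X⁻ t z∈X
  ... | no z∉X  = ⊥-elim (all∈X (lose (separates-⊆ t s z∈) z∉X))
... | yes some = SameBlock-trans (unique v′) (SameBlock-sym (toAnchor′ aˣ (SameBlock⇒∈ˡ b)))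
  (SameBlock-trans (unique v′) anchors-together (toAnchor′ aʸ (SameBlock⇒∈ʳ b)))
  where
  N = complementIn (supp π) X
  n∈N = ∈-complementIn⁺ {supp π} {X} (proj₁ (proj₂ (find some))) (proj₂ (proj₂ (find some)))
  u = anchor N x
  w = anchor N y
  aˣ = anchor-Anchor x n∈N
  aʸ = anchor-Anchor y n∈N
  toAnchor : ∀ {z v} → Anchor N z v → z ∈ supp π → SameBlock π v z
  toAnchor a z∈ = anchor-~ (SameBlock-refl π) (SameBlock-trans (unique v))
    (λ m → proj₁ (∈-complementIn⁻ (supp π) X m)) a z∈ (λ z∈ z∉ → X⁻ s (∉-complementIn z∈ z∉))
  toAnchor′ : ∀ {z v} → Anchor N z v → z ∈ supp π → SameBlock π′ v z
  toAnchor′ a z∈ = anchor-~ (SameBlock-refl π′) (SameBlock-trans (unique v′))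
    (λ m → separates-⊆ s t (proj₁ (∈-complementIn⁻ (supp π) X m))) a (separates-⊆ s t z∈)
    (λ z∈ z∉ → X⁻ t (∉-complementIn (separates-⊆ t s z∈) z∉))
  b-anchors : SameBlock π u w
  b-anchors = SameBlock-trans (unique v) (toAnchor aˣ (SameBlock⇒∈ˡ b))
    (SameBlock-trans (unique v) b (SameBlock-sym (toAnchor aʸ (SameBlock⇒∈ʳ b))))
  anchors-together : SameBlock π′ u w
  anchors-together with u ≟ w
  ... | yes e = subst (SameBlock π′ u) e (SameBlock-refl π′ (separates-⊆ s t (SameBlock⇒∈ˡ b-anchors)))
  ... | no u≢w = proj₁ (rest⁻ t (rest⁺ s b-anchors
    (proj₂ (∈-complementIn⁻ (supp π) X (anchor∈ aˣ))) (λ u∈Y → u≢w (sym (proj₂ (Y⁻ s u∈Y) b-anchors)))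
    (proj₂ (∈-complementIn⁻ (supp π) X (anchor∈ aʸ))) (λ w∈Y → u≢w (proj₂ (Y⁻ s w∈Y) (SameBlock-sym b-anchors)))))

SeparateST-injective : ∀ {π π′ ρ X Y} → Valid π → Valid π′ →
  Separates Term π ρ X Y → Separates Term π′ ρ X Y → π ≡ π′
SeparateST-injective v v′ s t = valid-ext v v′
  (SeparateST-reflects-SameBlock v v′ s t) (SeparateST-reflects-SameBlock v′ v t s)

-- Neighbours of the initiators and singletons of a rest.

¬Sing⇒partner : ∀ {π x} → x ∈ supp π → ¬ Sing π x → ∃[ y ] (SameBlock π x y × y ≢ x)
¬Sing⇒partner {π} {x} x∈ ¬s with Any.any? (λ y → T? (sameBlock π x y) ×-dec ¬? (y ≟ x)) (supp π)
... | yes some = let y , _ , b , y≢x = find some in y , sameBlock⁻ π b , y≢x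
... | no none  = ⊥-elim (¬s (x∈ , alone))
  where
  alone : ∀ {y} → SameBlock π x y → y ≡ x
  alone {y} b with y ≟ x
  ... | yes e  = e
  ... | no y≢x = ⊥-elim (none (lose (SameBlock⇒∈ʳ b) (sameBlock⁺ π b , y≢x)))

module _ {π ρ : Partition} {I S : List ℕ} (v : Valid π) (sep : Separates Init π ρ I S) where
  private
    A = supp π
    N = complementIn A I
    N⊆A : ∀ {z} → z ∈ N → z ∈ A
    N⊆A = proj₁ ∘ ∈-complementIn⁻ A I
    ρ⊆N : ∀ {z} → z ∈ supp ρ → z ∈ N
    ρ⊆N z∈ = let z∈A , z∉I , _ = rest-∈⁻ sep z∈ in ∈-complementIn⁺ z∈A z∉I

    -- A `Backward` anchor is found by walking forwards. Every initiator passed on the way shares a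
    -- block with its successor, so the first non-initiator lies in the block of `x`.
    anchored : ∀ {x a} → Backward.Anchor N x a → x ∈ A → SameBlock π a x
    anchored a x∈ = Backward.anchor-~ (SameBlock-refl π) (SameBlock-trans (unique v)) N⊆A a x∈
      λ z∈ z∉ → let p , s , b = X⁻ sep (∉-complementIn z∈ z∉) in p , Succ⇒Backward s , SameBlock-sym b

    Sing-anchor : ∀ {x a} → Backward.Anchor N x a → x ∈ A → a ∈ S → x ≡ a
    Sing-anchor a x∈ a∈S = proj₂ (Y⁻ sep a∈S) (anchored a x∈)

  -- If `s` were not in `S`, the first non-initiator `a` from `s` onwards would survive in `ρ` and
  -- be the successor of `x` there. The adjacency in `ρ` then puts `a` into the block of `x`. As `s`
  -- lies in the block of `a`, it would share a block with `x`, and `x` would have been deleted as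
  -- an initiator of `π`.
  Init-rest⇒successor∈S : ∀ {x s} → Init ρ x → Succ A x s → s ∈ S
  Init-rest⇒successor∈S {x} {s} (y , σ , b) τ with s ∈? S
  ... | yes s∈S = s∈S
  ... | no s∉S = ⊥-elim (proj₁ (proj₂ (rest-∈⁻ sep (source∈ σ)))
      (X⁺ sep (s , τ , SameBlock-trans (unique v) (proj₁ (rest⁻ sep bₐ)) (anchored anc (target∈ τ)))))
    where
    x∈N = ρ⊆N (source∈ σ)
    a = Backward.anchor N s
    anc = Backward.anchor-Anchor s x∈N
    a∈N = ∈-complementIn⁻ A I (Backward.Anchor.anchor∈ anc)
    a∈ρ : a ∈ supp ρ
    a∈ρ = rest-∈⁺ sep (proj₁ a∈N) (proj₂ a∈N)
      (λ a∈S → s∉S (subst (_∈ S) (sym (Sing-anchor anc (target∈ τ) a∈S)) a∈S))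
    next : Succ (supp ρ) x a
    next = Backward⇒Succ (Backward.anchor-Succ N⊆A ρ⊆N (Succ⇒Backward τ) anc a∈ρ (source∈ σ))
    bₐ : SameBlock ρ x a
    bₐ = subst (SameBlock ρ x) (Succ-unique σ next) b

  -- In `π` the element `y` is no singleton, so its block contains some other `z`. The first
  -- non-initiator from `z` onwards lies in that block and survives in `ρ`, hence it is `y`. So the
  -- walk from `z` to `y` meets only initiators, and its last one is the predecessor of `y`.
  Sing-rest⇒predecessor∈I : ∀ {p y} → Sing ρ y → Succ A p y → p ∈ I
  Sing-rest⇒predecessor∈I {p} {y} (y∈ρ , alone) σ =
    ∉-complementIn (source∈ σ) (Backward.anchor-Succ∉ N⊆A anc-y z∈A z∉N (Succ⇒Backward σ))
    where
    y∈ = rest-∈⁻ sep y∈ρ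
    partner = ¬Sing⇒partner (proj₁ y∈) (λ s → proj₂ (proj₂ y∈) (Y⁺ sep s))
    z = proj₁ partner
    b = proj₁ (proj₂ partner)
    z≢y = proj₂ (proj₂ partner)
    z∈A = SameBlock⇒∈ʳ b
    a = Backward.anchor N z
    anc = Backward.anchor-Anchor z (ρ⊆N y∈ρ)
    a∈N = ∈-complementIn⁻ A I (Backward.Anchor.anchor∈ anc)
    b′ : SameBlock π y a
    b′ = SameBlock-trans (unique v) b (SameBlock-sym (anchored anc z∈A))
    a∉S : a ∉ S
    a∉S a∈S = proj₂ (proj₂ y∈) (subst (_∈ S) (sym (proj₂ (Y⁻ sep a∈S) (SameBlock-sym b′))) a∈S)
    a≡y : a ≡ y
    a≡y = alone (rest⁺ sep b′ (proj₁ (proj₂ y∈)) (proj₂ (proj₂ y∈)) (proj₂ a∈N) a∉S)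
    anc-y : Backward.Anchor N z y
    anc-y = subst (Backward.Anchor N z) a≡y anc
    z∉N : z ∉ N
    z∉N z∈N = z≢y (trans (sym (Backward.Anchor.fixed anc z∈N)) a≡y)

-- The image of `SeparateST`.

anchor-skip-≡ : ∀ {A} N {x y} → (∀ {z} → z ∈ N → z ∈ A) → Succ A x y → y ∉ N → anchor N x ≡ anchor N y
-- Both anchors are the junk value 0. This is the right behaviour: if every element lies in `S`, all
-- anchors agree and `combination` becomes a single block.
anchor-skip-≡ []       _   _ _  = refl
anchor-skip-≡ (n ∷ ns) N⊆A s y∉ = Anchor-unique
  (anchor-skip N⊆A s y∉ (anchor-Anchor _ (here refl))) (anchor-Anchor _ (here refl))

-- The invariant carried up a chain: what has to be known of the transformed rest in order to
-- recombine one level higher.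
record Exchange (π τ : Partition) : Set where
  field
    valid-τ : Valid τ
    supp⁺   : ∀ {x} → x ∈ supp π → x ∈ supp τ
    supp⁻   : ∀ {x} → x ∈ supp τ → x ∈ supp π
    term⁺   : ∀ {x} → Sing π x → Term τ x
    term⁻   : ∀ {x} → Term τ x → Sing π x
    sing⁺   : ∀ {x} → Init π x → Sing τ x
    sing⁻   : ∀ {x} → Sing τ x → Init π x

open Exchange

subsingleton-or-plural : ∀ {A : List ℕ} → Unique A →
  (∀ {x y} → x ∈ A → y ∈ A → x ≡ y) ⊎ (∀ x → ∃[ y ] (y ∈ A × y ≢ x))
subsingleton-or-plural {[]}     _ = inj₁ λ ()
subsingleton-or-plural {_ ∷ []} _ = inj₁ λ { (here refl) (here refl) → refl }
subsingleton-or-plural {a ∷ b ∷ A} ((a≢b ∷ _) ∷ _) = inj₂ other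
  where
  other : ∀ x → ∃[ y ] (y ∈ a ∷ b ∷ A × y ≢ x)
  other x with a ≟ x
  ... | yes refl = b , there (here refl) , a≢b ∘ sym
  ... | no a≢x   = a , here refl , a≢x

module _ {π ρ σ : Partition} {I S : List ℕ} (v : Valid π) (sep : Separates Init π ρ I S) (ex : Exchange ρ σ) where
  private
    A = supp π
    I⊆A : ∀ {x} → x ∈ I → x ∈ A
    I⊆A = Init-supp ∘ X⁻ sep
    S⊆A : ∀ {x} → x ∈ S → x ∈ A
    S⊆A = proj₁ ∘ Y⁻ sep
    σ-rest : ∀ {x} → x ∈ supp σ → x ∈ A × x ∉ I × x ∉ S
    σ-rest = rest-∈⁻ sep ∘ supp⁻ ex

  -- Here every element belongs to both `I` and `S`, the rest is empty, and `π` itself is the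
  -- preimage.
  combine-subsingleton : (∀ {x y} → x ∈ A → y ∈ A → x ≡ y) → Separates Term π σ S I
  combine-subsingleton small = record
    { rest-valid   = valid-τ ex
    ; X-increasing = Y-increasing sep
    ; Y-increasing = X-increasing sep
    ; X⁺ = λ t → inS (Term-supp t)
    ; X⁻ = λ x∈S → let x∈ = S⊆A x∈S in _ , self x∈ , SameBlock-refl π x∈
    ; Y⁺ = λ s → X⁺ sep (_ , self (proj₁ s) , SameBlock-refl π (proj₁ s))
    ; Y⁻ = λ x∈I → I⊆A x∈I , λ b → small (SameBlock⇒∈ʳ b) (SameBlock⇒∈ˡ b)
    ; rest⁺ = λ b x∉S _ _ _ → ⊥-elim (x∉S (inS (SameBlock⇒∈ˡ b)))
    ; rest⁻ = λ b → let x∈A , _ , x∉S = σ-rest (SameBlock⇒∈ˡ b) in ⊥-elim (x∉S (inS x∈A))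
    }
    where
    inS : ∀ {x} → x ∈ A → x ∈ S
    inS x∈ = Y⁺ sep (x∈ , λ b → small (SameBlock⇒∈ʳ b) x∈)
    self : ∀ {x} → x ∈ A → Succ A x x
    self x∈ = mkSucc x∈ x∈ (λ z∈ c → IsCyclicOrder.irrefl₁₃ Cyc-isCyclicOrder c) (λ _ z∈ → small z∈ x∈)

  module Combination (plural : ∀ x → ∃[ y ] (y ∈ A × y ≢ x)) where
    private
      N = complementIn A S
      N⊆A : ∀ {z} → z ∈ N → z ∈ A
      N⊆A = proj₁ ∘ ∈-complementIn⁻ A S
      anc : ℕ → ℕ
      anc = anchor N

    -- Elements of `S` must join their predecessors, hence the block of their anchor outside `S`.
    -- Anchors in the support of `σ` are merged as in `σ`; an anchor in `I` is merged with no other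
    -- anchor.
    related : ℕ → ℕ → Bool
    related x y = (anc x ≡ᵇ anc y) ∨ sameBlock σ (anc x) (anc y)

    Related : ℕ → ℕ → Set
    Related x y = anc x ≡ anc y ⊎ SameBlock σ (anc x) (anc y)

    related⁺ : ∀ {x y} → Related x y → T (related x y)
    related⁺ {x} {y} (inj₁ e) = Equivalence.from (T-∨ {anc x ≡ᵇ anc y}) (inj₁ (≡⇒≡ᵇ (anc x) (anc y) e))
    related⁺ {x} {y} (inj₂ b) = Equivalence.from (T-∨ {anc x ≡ᵇ anc y}) (inj₂ (sameBlock⁺ σ b))

    related⁻ : ∀ {x y} → T (related x y) → Related x y
    related⁻ {x} {y} t with Equivalence.to (T-∨ {anc x ≡ᵇ anc y}) t
    ... | inj₁ e = inj₁ (≡ᵇ⇒≡ (anc x) (anc y) e)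
    ... | inj₂ b = inj₂ (sameBlock⁻ σ b)

    Related-trans : ∀ {x y z} → Related x y → Related y z → Related x z
    Related-trans {x} {y} {z} (inj₁ e) q rewrite e = q
    Related-trans {x} {y} {z} (inj₂ b) (inj₁ e) = inj₂ (subst (SameBlock σ (anc x)) e b)
    Related-trans (inj₂ b) (inj₂ c) = inj₂ (SameBlock-trans (unique (valid-τ ex)) b c)

    Related-sym : ∀ {x y} → Related x y → Related y x
    Related-sym (inj₁ e) = inj₁ (sym e)
    Related-sym (inj₂ b) = inj₂ (SameBlock-sym b)

    related-equivalence : EquivalenceOn A related
    related-equivalence = record
      { refl-on = λ {x} _ → related⁺ {x} (inj₁ refl)
      ; symm    = λ {x} {y} t → related⁺ {y} (Related-sym (related⁻ {x} t))
      ; tran    = λ {x} {y} {z} s t → related⁺ {x} (Related-trans {x} {y} {z} (related⁻ {x} s) (related⁻ {y} t)) }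

    private module C = Classes (supp-increasing v) related-equivalence

    combination : Partition
    combination = classes A related

    private
      c = combination
      block⁺ : ∀ {x y} → x ∈ A → y ∈ A → Related x y → SameBlock c x y
      block⁺ x∈ y∈ r = C.SameBlock-classes⁺ x∈ y∈ (related⁺ r)
      block⁻ : ∀ {x y} → SameBlock c x y → x ∈ A × y ∈ A × Related x y
      block⁻ {x} b = let x∈ , y∈ , r = C.SameBlock-classes⁻ b in x∈ , y∈ , related⁻ {x} r

      anchor-fixed : ∀ {x} → x ∈ N → anc x ≡ x
      anchor-fixed {x} x∈ = fixed (anchor-Anchor x x∈) x∈
      σ⊆N : ∀ {x} → x ∈ supp σ → x ∈ N
      σ⊆N x∈ = let x∈A , _ , x∉S = σ-rest x∈ in ∈-complementIn⁺ x∈A x∉S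
      fixed-σ : ∀ {x} → x ∈ supp σ → anc x ≡ x
      fixed-σ = anchor-fixed ∘ σ⊆N
      σ⇒c : ∀ {x y} → SameBlock σ x y → SameBlock c x y
      σ⇒c b = block⁺ (proj₁ (σ-rest (SameBlock⇒∈ˡ b))) (proj₁ (σ-rest (SameBlock⇒∈ʳ b)))
        (inj₂ (subst₂ (SameBlock σ) (sym (fixed-σ (SameBlock⇒∈ˡ b))) (sym (fixed-σ (SameBlock⇒∈ʳ b))) b))

      -- A singleton that is an initiator would be its own successor, which `plural` forbids.
      I⇒∉S : ∀ {x} → x ∈ I → x ∉ S
      I⇒∉S {x} x∈I x∈S with y , s , b ← X⁻ sep x∈I | z , z∈ , z≢x ← plural x =
        z≢x (loop s (sym (proj₂ (Y⁻ sep x∈S) b)) z∈)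
      I⊆N : ∀ {x} → x ∈ I → x ∈ N
      I⊆N x∈I = ∈-complementIn⁺ (I⊆A x∈I) (I⇒∉S x∈I)
      -- An element of `I` anchors only itself. Otherwise its successor would lie in `S`, although
      -- the two share a block.
      skipped⇒∉I : ∀ {x y} → Anchor N x y → x ∈ A → x ∉ N → y ∉ I
      skipped⇒∉I a x∈ x∉N y∈I with s , σ′ , b ← X⁻ sep y∈I
        with s∈S ← ∉-complementIn (target∈ σ′) (anchor-Succ∉ N⊆A a x∈ x∉N σ′) =
        I⇒∉S y∈I (subst (_∈ S) (sym (proj₂ (Y⁻ sep s∈S) (SameBlock-sym b))) s∈S)

      S⇒Term : ∀ {y} → y ∈ S → ∃[ p ] (Succ A p y × p ≢ y × SameBlock c p y)
      S⇒Term {y} y∈S with z , z∈ , z≢y ← plural y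
        with p , s , p≢y ← predecessor (S⊆A y∈S) z∈ z≢y =
        p , s , p≢y , block⁺ (source∈ s) (target∈ s)
          (inj₁ (anchor-skip-≡ N N⊆A s (λ y∈N → proj₂ (∈-complementIn⁻ A S y∈N) y∈S)))

      -- Suppose `y` is not in `S`, so that it is its own anchor. If `y` is in `I`, it lies outside
      -- `σ`, so `x` would be anchored at `y`, against `skipped⇒∉I`. Otherwise the anchor of `x`
      -- precedes `y` in `σ` within one block, so `y` is a singleton of `ρ` and its predecessor `x`
      -- lies in `I`. But then `x` is its own anchor and lies in `σ`, which avoids `I`.
      Term⇒S : ∀ {x y} → Succ A x y → SameBlock c x y → y ∈ S
      Term⇒S {x} {y} s b with y ∈? S
      ... | yes y∈S = y∈S
      ... | no y∉S = ⊥-elim impossible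
        where
        y∈N = ∈-complementIn⁺ (target∈ s) y∉S
        a = anchor-Anchor x y∈N
        anchors : anc x ≡ y ⊎ SameBlock σ (anc x) y
        anchors with proj₂ (proj₂ (block⁻ b))
        ... | inj₁ e  = inj₁ (trans e (anchor-fixed y∈N))
        ... | inj₂ b′ = inj₂ (subst (SameBlock σ (anc x)) (anchor-fixed y∈N) b′)
        impossible : ⊥
        impossible with y ∈? I
        impossible | yes y∈I with anchors
        ... | inj₂ b′ = proj₁ (proj₂ (σ-rest (SameBlock⇒∈ʳ b′))) y∈I
        ... | inj₁ e  = skipped⇒∉I (subst (Anchor N x) e a) (source∈ s) x∉N y∈I
          where
          x∉N : x ∉ N
          x∉N x∈N with z , z∈ , z≢x ← plural x = z≢x (loop s (trans (sym (fixed a x∈N)) e) z∈)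
        impossible | no y∉I = proj₁ (proj₂ (σ-rest ancx∈σ)) (subst (_∈ I) (sym (anchor-fixed (I⊆N x∈I))) x∈I)
          where
          y∈σ = supp⁺ ex (rest-∈⁺ sep (target∈ s) y∉I y∉S)
          b′ : SameBlock σ (anc x) y
          b′ with anchors
          ... | inj₁ e  = subst (λ w → SameBlock σ w y) (sym e) (SameBlock-refl σ y∈σ)
          ... | inj₂ b″ = b″
          ancx∈σ = SameBlock⇒∈ˡ b′
          x∈I : x ∈ I
          x∈I = Sing-rest⇒predecessor∈I v sep
            (term⁻ ex (anc x , anchor-Succ N⊆A σ⊆N s a ancx∈σ y∈σ , b′)) s

      -- An element of `S` is joined to its predecessor. An element `y` outside `I` and `S` would be
      -- a singleton of `σ`, hence an initiator of `ρ`, so its successor would lie in `S` and be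
      -- joined to `y`.
      Sing⇒I : ∀ {y} → y ∈ A → (∀ {z} → SameBlock c y z → z ≡ y) → y ∈ I
      Sing⇒I {y} y∈ alone with y ∈? S | y ∈? I
      ... | _       | yes y∈I = y∈I
      ... | yes y∈S | no _ with p , _ , p≢y , b ← S⇒Term y∈S = ⊥-elim (p≢y (alone (SameBlock-sym b)))
      ... | no y∉S  | no y∉I = ⊥-elim (y∉S (subst (_∈ S) (alone b) s∈S))
        where
        s = successor A y
        succ-y = successor-supp v y∈
        s∈S : s ∈ S
        s∈S = Init-rest⇒successor∈S v sep
          (sing⁻ ex (supp⁺ ex (rest-∈⁺ sep y∈ y∉I y∉S) , λ b → alone (σ⇒c b))) succ-y
        b : SameBlock c y s
        b = block⁺ y∈ (target∈ succ-y)
          (inj₁ (anchor-skip-≡ N N⊆A succ-y (λ s∈N → proj₂ (∈-complementIn⁻ A S s∈N) s∈S)))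

      I-unrelated : ∀ {y z} → y ∈ I → z ∈ A → Related y z → z ≡ y
      I-unrelated y∈I _ (inj₂ b) = ⊥-elim (proj₁ (proj₂ (σ-rest (SameBlock⇒∈ˡ b)))
        (subst (_∈ I) (sym (anchor-fixed (I⊆N y∈I))) y∈I))
      I-unrelated {y} {z} y∈I z∈ (inj₁ e) with z ∈? S
      ... | no z∉S  = trans (sym (anchor-fixed (∈-complementIn⁺ z∈ z∉S)))
        (trans (sym e) (anchor-fixed (I⊆N y∈I)))
      ... | yes z∈S = ⊥-elim (skipped⇒∉I
        (subst (Anchor N z) (trans (sym e) (anchor-fixed (I⊆N y∈I))) (anchor-Anchor z (I⊆N y∈I)))
        z∈ (λ z∈N → proj₂ (∈-complementIn⁻ A S z∈N) z∈S) y∈I)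

      I⇒alone : ∀ {y z} → y ∈ I → SameBlock c y z → z ≡ y
      I⇒alone y∈I b = let _ , z∈ , r = block⁻ b in I-unrelated y∈I z∈ r

      supp-c : supp c ≡ A
      supp-c = C.supp-classes

    combination-valid : Valid combination
    combination-valid = C.classes-valid

    combination-Separates : Separates Term combination σ S I
    combination-Separates = record
      { rest-valid   = valid-τ ex
      ; X-increasing = Y-increasing sep
      ; Y-increasing = X-increasing sep
      ; X⁺ = λ (_ , s , b) → Term⇒S (subst (λ B → Succ B _ _) supp-c s) b
      ; X⁻ = λ y∈S → let p , s , _ , b = S⇒Term y∈S in p , subst (λ B → Succ B _ _) (sym supp-c) s , b
      ; Y⁺ = λ (y∈ , alone) → Sing⇒I (subst (_ ∈_) supp-c y∈) alone
      ; Y⁻ = λ y∈I → subst (_ ∈_) (sym supp-c) (I⊆A y∈I) , I⇒alone y∈I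
      ; rest⁺ = rest⁺′
      ; rest⁻ = λ b → let _ , x∉I , x∉S = σ-rest (SameBlock⇒∈ˡ b) in σ⇒c b , x∉S , x∉I
      }
      where
      rest⁺′ : ∀ {x y} → SameBlock c x y → x ∉ S → x ∉ I → y ∉ S → y ∉ I → SameBlock σ x y
      rest⁺′ {x} {y} b x∉S x∉I y∉S y∉I with x∈ , y∈ , r ← block⁻ b
        with x∈σ ← supp⁺ ex (rest-∈⁺ sep x∈ x∉I x∉S) | y∈σ ← supp⁺ ex (rest-∈⁺ sep y∈ y∉I y∉S) with r
      ... | inj₁ e  = subst (SameBlock σ x) (trans (sym (fixed-σ x∈σ)) (trans e (fixed-σ y∈σ))) (SameBlock-refl σ x∈σ)
      ... | inj₂ b′ = subst₂ (SameBlock σ) (fixed-σ x∈σ) (fixed-σ y∈σ) b′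

  combine-exists : ∃[ c ] (Valid c × Separates Term c σ S I)
  combine-exists with subsingleton-or-plural (increasing⇒unique (supp-increasing v))
  ... | inj₁ small  = π , v , combine-subsingleton small
  ... | inj₂ plural = _ , Combination.combination-valid plural , Combination.combination-Separates plural

-- Chains of separations.

-- The constructors overlap: a partition without initiators and singletons also admits steps with
-- empty sets. This matches `φ`, which performs one separation even there.
data Conj : Partition → Partition → Set where
  stop : ∀ {π} → Valid π → (∀ {x} → ¬ Init π x) → (∀ {x} → ¬ Sing π x) → Conj π π
  step : ∀ {π τ ρ σ I S} → Valid π → Valid τ →
    Separates Init π ρ I S → Separates Term τ σ S I → Conj ρ σ → Conj π τ

Conj-Exchange : ∀ {π τ} → Conj π τ → Exchange π τ
Conj-Exchange (stop v ¬i ¬s) = record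
  { valid-τ = v ; supp⁺ = λ x∈ → x∈ ; supp⁻ = λ x∈ → x∈
  ; term⁺ = ⊥-elim ∘ ¬s ; term⁻ = λ (x , s , b) → ⊥-elim (¬i (_ , s , b))
  ; sing⁺ = ⊥-elim ∘ ¬i ; sing⁻ = ⊥-elim ∘ ¬s }
Conj-Exchange {π} {τ} (step v w s t k) = record
  { valid-τ = w ; supp⁺ = supp⁺′ ; supp⁻ = supp⁻′
  ; term⁺ = X⁻ t ∘ Y⁺ s ; term⁻ = Y⁻ s ∘ X⁺ t
  ; sing⁺ = Y⁻ t ∘ X⁺ s ; sing⁻ = X⁻ s ∘ Y⁺ t }
  where
  supp⁺′ : ∀ {x} → x ∈ supp π → x ∈ supp τ
  supp⁺′ x∈ with trichotomy s x∈
  ... | inj₁ x∈I        = proj₁ (Y⁻ t x∈I)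
  ... | inj₂ (inj₁ x∈S) = Term-supp (X⁻ t x∈S)
  ... | inj₂ (inj₂ x∈ρ) = proj₁ (rest-∈⁻ t (supp⁺ (Conj-Exchange k) x∈ρ))
  supp⁻′ : ∀ {x} → x ∈ supp τ → x ∈ supp π
  supp⁻′ x∈ with trichotomy t x∈
  ... | inj₁ x∈S        = proj₁ (Y⁻ s x∈S)
  ... | inj₂ (inj₁ x∈I) = Init-supp (X⁻ s x∈I)
  ... | inj₂ (inj₂ x∈σ) = proj₁ (rest-∈⁻ s (supp⁻ (Conj-Exchange k) x∈σ))

separates-none : ∀ {Adj π ρ X Y} → Valid π → Separates Adj π ρ X Y →
  (∀ {x} → x ∉ X) → (∀ {x} → x ∉ Y) → ρ ≡ π
separates-none v s ∉X ∉Y = valid-ext (rest-valid s) v (proj₁ ∘ rest⁻ s) (λ b → rest⁺ s b ∉X ∉Y ∉X ∉Y)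

-- Only steps with empty `I` and `S` are possible, and these change neither end of the chain.
Conj-stop : ∀ {π τ} → Conj π τ → (∀ {x} → ¬ Init π x) → (∀ {x} → ¬ Sing π x) → τ ≡ π
Conj-stop (stop _ _ _) _ _ = refl
Conj-stop (step v w s t k) ¬i ¬s
  with refl ← separates-none v s (¬i ∘ X⁻ s) (¬s ∘ Y⁻ s)
     | refl ← separates-none w t (¬s ∘ Y⁻ s) (¬i ∘ X⁻ s) = Conj-stop k ¬i ¬s

-- Going down, separations are determined by `π`; coming back up, `τ` is recovered by injectivity of
-- `SeparateST`.
Conj-functional : ∀ {π τ τ′} → Conj π τ → Conj π τ′ → τ ≡ τ′
Conj-functional (stop v ¬i ¬s) k = sym (Conj-stop k ¬i ¬s)
Conj-functional k@(step _ _ _ _ _) (stop v ¬i ¬s) = Conj-stop k ¬i ¬s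
Conj-functional (step v w s t k) (step v′ w′ s′ t′ k′)
  with refl ← separates-determined s s′
  with refl ← Conj-functional k k′ = SeparateST-injective w w′ t t′

-- The loop of `φ` produces a chain.

recombine : List (List ℕ × List ℕ) × Partition → Partition
recombine r = foldr (λ IS τ → CombineST τ (proj₂ IS , proj₁ IS)) (proj₂ r) (proj₁ r)

finished : Partition → Bool
finished ρ = null (initiators ρ) ∧ null (singletons ρ)

-- The graph of one round of the loop, with the outcome of the test as an index, so that the case
-- distinction inside `separateLoop` is reproduced only once.
data LoopStep : ℕ → Partition × (List ℕ × List ℕ) → Bool → List (List ℕ × List ℕ) × Partition → Set where
  done      : ∀ {f ρ IS} → LoopStep f (ρ , IS) true ([ IS ] , ρ)
  exhausted : ∀ {ρ IS} → LoopStep 0 (ρ , IS) false ([ IS ] , ρ)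
  continue  : ∀ {f ρ IS} → LoopStep (suc f) (ρ , IS) false (IS ∷ proj₁ (separateLoop f ρ) , proj₂ (separateLoop f ρ))

separateLoop-step : ∀ f ρ → LoopStep f (SeparateIS ρ) (finished (proj₁ (SeparateIS ρ))) (separateLoop f ρ)
separateLoop-step f ρ with finished (proj₁ (SeparateIS ρ)) | f
... | true  | _     = done
... | false | zero  = exhausted
... | false | suc g = continue

null⇒∉ : ∀ {X : List ℕ} {x} → T (null X) → x ∉ X
null⇒∉ {[]} _ ()

∉⇒null : ∀ {X : List ℕ} → (∀ {x} → x ∉ X) → T (null X)
∉⇒null {[]}    _  = _
∉⇒null {x ∷ _} x∉ = ⊥-elim (x∉ (here refl))

finished⇒stop : ∀ {ρ} → Valid ρ → T (finished ρ) → Conj ρ ρ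
finished⇒stop {ρ} v t with ti , ts ← Equivalence.to (T-∧ {null (initiators ρ)}) t =
  stop v (null⇒∉ ti ∘ X⁺ (SeparateIS-Separates v)) (null⇒∉ ts ∘ singletons⁺ v)

supp-shrinks : ∀ {Adj π ρ X Y z} → Valid π → Separates Adj π ρ X Y → z ∈ supp π → z ∈ X ⊎ z ∈ Y →
  length (supp ρ) < length (supp π)
supp-shrinks {π = π} {ρ} {X} {Y} {z} v s z∈ z∈XY = subst (λ A → length A < length (supp π)) (sym ρ≡)
  (filter-notAll (_∈? supp ρ) (supp π) (lose z∈ (z∉ z∈XY)))
  where
  z∉ : z ∈ X ⊎ z ∈ Y → z ∉ supp ρ
  z∉ (inj₁ z∈X) z∈ρ = proj₁ (proj₂ (rest-∈⁻ s z∈ρ)) z∈X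
  z∉ (inj₂ z∈Y) z∈ρ = proj₂ (proj₂ (rest-∈⁻ s z∈ρ)) z∈Y
  ρ≡ : supp ρ ≡ filter (_∈? supp ρ) (supp π)
  ρ≡ = increasing-ext (supp-increasing (rest-valid s))
    (AllPairs.filter⁺ (_∈? supp ρ) (supp-increasing v))
    (λ x∈ → ∈-filter⁺ (_∈? supp ρ) (proj₁ (rest-∈⁻ s x∈)) x∈)
    (λ x∈ → proj₂ (∈-filter⁻ (_∈? supp ρ) {xs = supp π} x∈))

-- If `I` and `S` are both empty, then `ρ` is `π`, which has no initiators and no singletons, so the
-- test would have succeeded.
unfinished⇒shrinks : ∀ {π ρ I S} → Valid π → Separates Init π ρ I S → ¬ T (finished ρ) →
  length (supp ρ) < length (supp π)
unfinished⇒shrinks {I = i ∷ I} v s n = supp-shrinks v s (Init-supp (X⁻ s (here refl))) (inj₁ (here refl))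
unfinished⇒shrinks {I = []} {S = j ∷ S} v s n = supp-shrinks v s (proj₁ (Y⁻ s (here refl))) (inj₂ (here refl))
unfinished⇒shrinks {π} {I = []} {S = []} v s n = ⊥-elim (n (subst (T ∘ finished)
  (sym (separates-none v s (λ ()) (λ ())))
  (Equivalence.from (T-∧ {null (initiators π)})
    (∉⇒null (λ x∈ → case X⁺ s (X⁻ (SeparateIS-Separates v) x∈) of λ ()) ,
     ∉⇒null (λ x∈ → case Y⁺ s (singletons⁻ v x∈) of λ ())))))

CombineST-Conj : ∀ {π ρ σ I S} → Valid π → Separates Init π ρ I S → Conj ρ σ → Conj π (CombineST σ (S , I))
CombineST-Conj v s k =
  let c , vc , t = combine-exists v s (Conj-Exchange k)
      vd , t′    = CombineST-Separates vc t
  in step v vd s t′ k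

Conj-recombine : ∀ f {π} → Valid π → length (supp π) ≤ f → Conj π (recombine (separateLoop f π))
LoopStep-Conj : ∀ f {ρ I S b r π} → LoopStep f (ρ , (I , S)) b r → b ≡ finished ρ →
  Valid π → Separates Init π ρ I S → length (supp π) ≤ f → Conj π (recombine r)

Conj-recombine f {π} v ≤f =
  LoopStep-Conj f {proj₁ (SeparateIS π)} {initiators π} {singletons π} {finished (proj₁ (SeparateIS π))}
    {separateLoop f π} {π} (separateLoop-step f π) refl v (SeparateIS-Separates v) ≤f

LoopStep-Conj f done e v s _ = CombineST-Conj v s (finished⇒stop (rest-valid s) (subst T e _))
-- The fuel bounds the size of the support; at fuel 0 the support is empty and cannot shrink.
LoopStep-Conj zero exhausted e v s ≤0 with () ← ≤-trans (unfinished⇒shrinks v s (subst T (sym e))) ≤0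
LoopStep-Conj (suc f) continue e v s ≤f = CombineST-Conj v s
  (Conj-recombine f (rest-valid s) (≤-pred (≤-trans (unfinished⇒shrinks v s (subst T (sym e))) ≤f)))

Conj-φ : ∀ {π} → Valid π → Conj π (φ π)
Conj-φ {π} v = Conj-recombine (length (supp π)) v ≤-refl

-- Counts, mirrored chains and the theorem.

Exchange-terminators : ∀ {π τ} → Valid π → Exchange π τ → terminators τ ≡ singletons π
Exchange-terminators v ex = increasing-ext (X-increasing s) (singletons-increasing v)
  (singletons⁺ v ∘ term⁻ ex ∘ X⁻ s) (X⁺ s ∘ term⁺ ex ∘ singletons⁻ v)
  where s = SeparateST-Separates (valid-τ ex)

Exchange-singletons : ∀ {π τ} → Valid π → Exchange π τ → singletons τ ≡ initiators π
Exchange-singletons v ex = increasing-ext (singletons-increasing (valid-τ ex)) (X-increasing s)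
  (X⁺ s ∘ sing⁻ ex ∘ singletons⁻ (valid-τ ex)) (singletons⁺ (valid-τ ex) ∘ sing⁺ ex ∘ X⁻ s)
  where s = SeparateIS-Separates v

length-adjacencies : ∀ π → length (adjacencies π) ≡ length (initiators π)
length-adjacencies π = length-map (λ a → a , successor (supp π) a) (initiators π)

module _ (n : ℕ) where
  open Complement n
  open Mirror

  mirror-Conj : ∀ {π τ π′ τ′} → Conj π τ → Mirror π π′ → Mirror τ τ′ → Conj τ′ π′
  mirror-Conj (stop v ¬i ¬s) m k with refl ← mirror-unique m k =
    -- An initiator of the mirror image reflects to a terminator of `π`, and the predecessor of a
    -- terminator is an initiator.
    stop (valid′ m) (λ i → ¬Term (mirror-Init (mirror-sym m) i)) (λ s → ¬s (mirror-Sing (mirror-sym m) s))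
    where
    ¬Term : ∀ {x} → ¬ Term _ x
    ¬Term (_ , s , b) = ¬i (_ , s , b)
  mirror-Conj {π} {τ} (step {ρ = ρ} {σ} v w s t k) m l =
    step (valid′ l) (valid′ m)
      (mirror-Separates {Term} {Init} mirror-Term mirror-Init Term-supp Init-supp l mσ t)
      (mirror-Separates {Init} {Term} mirror-Init mirror-Term Init-supp Term-supp m mρ s)
      (mirror-Conj k mρ mσ)
    where
    mρ : Mirror ρ (complement n ρ)
    mρ = complement-Mirror (rest-valid s) (λ x∈ → bounded m (proj₁ (rest-∈⁻ s x∈)))
    mσ : Mirror σ (complement n σ)
    mσ = complement-Mirror (rest-valid t) (λ x∈ → bounded l (proj₁ (rest-∈⁻ t x∈)))

  length-reflectSet : ∀ X → length (reflectSet X) ≡ length X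
  length-reflectSet X = trans (length-sort (map reflect X)) (length-map reflect X)

  module _ {τ κ} (m : Mirror τ κ) where
    private
      s = SeparateST-Separates (valid m)
      rest-mirror = complement-Mirror (rest-valid s) (λ x∈ → bounded m (proj₁ (rest-∈⁻ s x∈)))
      mirrored : (proj₁ (SeparateIS κ) , (initiators κ , singletons κ)) ≡
        (complement n (proj₁ (SeparateST τ)) , (reflectSet (terminators τ) , reflectSet (singletons τ)))
      mirrored = separates-determined (SeparateIS-Separates (valid′ m))
        (mirror-Separates {Term} {Init} mirror-Term mirror-Init Term-supp Init-supp m rest-mirror s)

    mirror-initiators : initiators κ ≡ reflectSet (terminators τ)
    mirror-initiators = cong (proj₁ ∘ proj₂) mirrored

    mirror-singletons : singletons κ ≡ reflectSet (singletons τ)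
    mirror-singletons = cong (proj₂ ∘ proj₂) mirrored

  module _ {π τ κ} (p : PartitionOf n π) (k : Conj π τ) (m : Mirror τ κ) where
    private
      v : Valid π
      v = record { unique = PartitionOf.disjoint p ; canonical = PartitionOf.canonical p }
      ex = Conj-Exchange k
      m′ : Mirror π (complement n π)
      m′ = complement-Mirror v (λ x∈ → Equivalence.to (PartitionOf.support p _) (∈-sort⁻ {concat π} x∈))

    mirror-PartitionOf : All (λ B → null B ≡ false) κ → PartitionOf n κ
    mirror-PartitionOf nonempty = record
      { blocksNonempty = nonempty
      ; disjoint       = Valid.unique (valid′ m)
      ; support        = λ x → mk⇔
          (λ x∈ → bounded′ m (∈-sort⁺ {concat κ} x∈))
          (λ bx → ∈-sort⁻ {concat κ} (subst (_∈ supp κ) (reflect-involutive bx)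
            (Mirror.supp⁺ m (Exchange.supp⁺ ex
              (∈-sort⁺ {concat π} (Equivalence.from (PartitionOf.support p _) (reflect-bounded bx)))))))
      ; canonical      = Valid.canonical (valid′ m)
      }

    -- The mirrored chain leads from `κ` to the complement of `π`. Another chain leads from `κ` to
    -- `φ κ`, so the two endpoints agree, and a second reflection gives back `π`.
    conjugate-mirror : conjugate n κ ≡ π
    conjugate-mirror = trans
      (cong (complement n) (Conj-functional (Conj-φ (valid′ m)) (mirror-Conj k m′ m)))
      (mirror-unique (complement-Mirror (valid′ m′) (bounded′ m′)) (mirror-sym m′))

    length-singletons-mirror : length (singletons κ) ≡ length (adjacencies π)
    length-singletons-mirror = trans (cong length (mirror-singletons m))
      (trans (length-reflectSet (singletons τ))
        (trans (cong length (Exchange-singletons v ex)) (sym (length-adjacencies π))))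

    length-adjacencies-mirror : length (adjacencies κ) ≡ length (singletons π)
    length-adjacencies-mirror = trans (length-adjacencies κ) (trans (cong length (mirror-initiators m))
      (trans (length-reflectSet (terminators τ)) (cong length (Exchange-terminators v ex))))

conjugation : ∀ n {π τ κ} → PartitionOf n π → Conj π τ → κ ≡ complement n τ →
  PartitionOf n κ
  × conjugate n κ ≡ π
  × length (singletons κ) ≡ length (adjacencies π)
  × length (adjacencies κ) ≡ length (singletons π)
conjugation n {π} {τ} {κ} p k e =
  mirror-PartitionOf n p k m nonempty , conjugate-mirror n p k m ,
  length-singletons-mirror n p k m , length-adjacencies-mirror n p k m
  where
  open Complement n
  ex = Conj-Exchange k
  bound : ∀ {x} → x ∈ supp τ → Bounded x
  bound x∈ = Equivalence.to (PartitionOf.support p _) (∈-sort⁻ {concat π} (supp⁻ ex x∈))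
  m : Mirror τ κ
  m = subst (Mirror τ) (sym e) (complement-Mirror (valid-τ ex) bound)
  nonempty : All (λ B → null B ≡ false) κ
  nonempty = subst (All (λ B → null B ≡ false)) (sym e) (complement-nonempty (valid-τ ex) bound)

theorem2 : (n : ℕ) → 1 ≤ n → (π : Partition) → PartitionOf n π →
    PartitionOf n (conjugate n π)
    × conjugate n (conjugate n π) ≡ π
    × length (singletons (conjugate n π)) ≡ length (adjacencies π)
    × length (adjacencies (conjugate n π)) ≡ length (singletons π)
theorem2 n _ π p = conjugation n {π} {φ π} {conjugate n π} p
  (Conj-φ (record { unique = PartitionOf.disjoint p ; canonical = PartitionOf.canonical p })) refl
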